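{- For every positive integer $n>2$ there is a prime number $p$ with $7n<p<8n$. -}

module Defs where

{-# OPTIONS --safe #-}
module Submission where

-- Chebyshev's method. Let L n = lcm(1, …, n), so that log L is Chebyshev's ψ, and n! = ∏ Λ(q)^⌊n/q⌋
-- with Λ(q) = L q / L (q − 1). An inequality Σ ±⌊Y/d⌋ ≤ Σ ±[k ≤ Y] between finite sums, valid for all
-- Y = ⌊X/q⌋, becomes an inequality between factorials (X/d)! and values L ⌊X/k⌋; when Σ ±1/d = 0,
-- Stirling's formula turns it into a linear bound on ψ(X) in terms of bounds on the ψ(X/k). Starting
-- from L n ≤ 4ⁿ and applying such inequalities with all d ∣ 210 a few times gives
-- 0.9377 x − O(1) ≤ ψ(x) ≤ 1.0702 x + O(1), and 8 · 0.9377 > 7 · 1.0702. On the other hand, if there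
-- is no prime in (7n, 8n), then every q ≤ 8n divides L (7n) · L √(8n), so ψ(8n) ≤ ψ(7n) + O(√n).
-- This is absurd for n ≥ 2 · 10⁷; smaller n are covered by an explicit chain of primes.

open import Defs
open import Data.Nat using (ℕ; _*_; _<_; _>_)
open import Data.Nat.Primality using (Prime)
open import Data.Product using (∃-syntax; _×_)
open import Data.Bool using (Bool; true; false; _∧_; if_then_else_; T)
open import Data.Bool.Properties using (T-∧)
open import Data.List using (List; []; _∷_; map; length)
open import Data.List.Relation.Unary.All as All using (All; []; _∷_; all?)
open import Data.Nat hiding (ℕ; _*_; _<_; _>_)
open import Data.Nat.Coprimality as Coprime using (Coprime; coprime-divisor; coprime-/gcd)
open import Data.Nat.Divisibility
open import Data.Nat.DivMod
open import Data.Nat.GCD using (gcd; gcd[m,n]∣m; gcd[m,n]∣n; gcd[m,n]≢0)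
open import Data.Nat.Induction using (<-rec)
open import Data.Nat.LCM using (lcm; m∣lcm[m,n]; n∣lcm[m,n]; lcm-least; gcd*lcm)
open import Data.Nat.ListAction using (sum; product)
open import Data.Nat.Primality hiding (Prime)
open import Data.Nat.Primality.Factorisation using (factorise; module PrimeFactorisation)
open import Data.Nat.Properties
open import Data.Nat.Tactic.RingSolver using (solve-∀)
open import Data.Product using (_,_; proj₁; proj₂)
open import Data.Sum using (_⊎_; inj₁; inj₂)
open import Function using (_∘_; Equivalence)
open import Relation.Binary.Definitions using (tri<; tri≈; tri>)
open import Relation.Binary.PropositionalEquality
open import Relation.Nullary
open import Relation.Nullary.Decidable using (True; toWitness; _×-dec_)

-- The von Mangoldt function

-- Every logarithmic statement is exponentiated and every quotient cross-multiplied, so only natural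
-- numbers occur, and a real slope becomes an integral exponent of 2. The obstacle is precision: the
-- two bounds on ψ must differ by a factor below 8/7, while Chebyshev's classical inequality with
-- divisors of 30 gives only 6/5. Step functions on both sides of the inequality repair this: ψ(X/k)
-- enters with weight about 1/k, so that a crude earlier bound on it does little harm, and
-- reapplying the inequality shrinks the harm further. The price is additive constants that grow
-- with each round. The final margin is 8 · 18182 - 7 · 20750 = 206, in units of 1/64 bit per 210
-- integers; it has to absorb those constants, which account for most of the threshold 2 · 10⁷, as
-- well as the √n term.

∏ : ℕ → (ℕ → ℕ) → ℕ
∏ zero    f = 1
∏ (suc n) f = ∏ n f * f n

∏-cong : ∀ n {f g} → (∀ i → i < n → f i ≡ g i) → ∏ n f ≡ ∏ n g
∏-cong zero    f≗g = refl
∏-cong (suc n) f≗g =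
  cong₂ _*_ (∏-cong n (λ i i<n → f≗g i (m<n⇒m<1+n i<n))) (f≗g n ≤-refl)

∏-mono-≤ : ∀ n {f g} → (∀ i → i < n → f i ≤ g i) → ∏ n f ≤ ∏ n g
∏-mono-≤ zero    f≤g = ≤-refl
∏-mono-≤ (suc n) f≤g =
  *-mono-≤ (∏-mono-≤ n (λ i i<n → f≤g i (m<n⇒m<1+n i<n))) (f≤g n ≤-refl)

∏-* : ∀ n f g → ∏ n (λ i → f i * g i) ≡ ∏ n f * ∏ n g
∏-* zero    f g = refl
∏-* (suc n) f g = trans (cong (_* (f n * g n)) (∏-* n f g))
                        ([m*n]*[o*p]≡[m*o]*[n*p] (∏ n f) (∏ n g) (f n) (g n))

∏-1 : ∀ n {f} → (∀ i → i < n → f i ≡ 1) → ∏ n f ≡ 1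
∏-1 zero    f≗1 = refl
∏-1 (suc n) f≗1 =
  cong₂ _*_ (∏-1 n (λ i i<n → f≗1 i (m<n⇒m<1+n i<n))) (f≗1 n ≤-refl)

∏-single : ∀ n c {f} → c < n → (∀ i → i < n → i ≢ c → f i ≡ 1) → ∏ n f ≡ f c
∏-single (suc n) c {f} c<1+n f≗1 with n ≟ c
... | yes refl = trans (cong (_* f n) (∏-1 n λ i i<n → f≗1 i (m<n⇒m<1+n i<n) (<⇒≢ i<n)))
                       (*-identityˡ (f n))
... | no n≢c = trans (cong₂ _*_ (∏-single n c (≤∧≢⇒< (s≤s⁻¹ c<1+n) (n≢c ∘ sym))
                                  (λ i i<n → f≗1 i (m<n⇒m<1+n i<n)))
                                (f≗1 n ≤-refl n≢c))
                     (*-identityʳ (f c))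

opaque
  -- Opaque, so that outside this block `L` never unfolds into an iterated `lcm`.
  L : ℕ → ℕ
  L zero    = 1
  L (suc n) = lcm (suc n) (L n)

  L-step-∣ : ∀ n → L n ∣ L (suc n)
  L-step-∣ n = n∣lcm[m,n] (suc n) (L n)

  L-suc-lcm : ∀ n → L (suc n) ≡ lcm (suc n) (L n)
  L-suc-lcm n = refl

  L-0 : L 0 ≡ 1
  L-0 = refl

  L-1 : L 1 ≡ 1
  L-1 = refl

  ∣L : ∀ {q n} → .{{NonZero q}} → q ≤ n → q ∣ L n
  ∣L {suc _} {zero}  ()
  ∣L {q}     {suc n} q≤1+n with m≤n⇒m<n∨m≡n q≤1+n
  ... | inj₁ q<1+n = ∣-trans (∣L (s≤s⁻¹ q<1+n)) (L-step-∣ n)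
  ... | inj₂ refl  = m∣lcm[m,n] (suc n) (L n)

  L∣ : ∀ n {c} → (∀ q → .{{NonZero q}} → q ≤ n → q ∣ c) → L n ∣ c
  L∣ zero    _   = 1∣ _
  L∣ (suc n) div = lcm-least (div (suc n) ≤-refl) (L∣ n (λ q q≤n → div q (m≤n⇒m≤1+n q≤n)))

  L≢0 : ∀ n → NonZero (L n)
  L≢0 zero    = _
  L≢0 (suc n) = ≢-nonZero λ lcm≡0 → ≢-nonZero⁻¹ (suc n * L n)
    {{m*n≢0 (suc n) (L n) {{_}} {{L≢0 n}}}}
    (trans (sym (gcd*lcm (suc n) (L n)))
           (trans (cong (gcd (suc n) (L n) *_) lcm≡0) (*-zeroʳ (gcd (suc n) (L n)))))

  L-mono-≤ : ∀ {m n} → m ≤ n → L m ≤ L n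
  L-mono-≤ {m} {n} m≤n = ∣⇒≤ {{L≢0 n}} (L∣ m (λ q q≤m → ∣L (≤-trans q≤m m≤n)))

-- The exponential of the von Mangoldt function, at suc i rather than i.
Λ : ℕ → ℕ
Λ i = quotient (L-step-∣ i)

L-suc : ∀ i → L (suc i) ≡ Λ i * L i
L-suc i = m∣n⇒n≡quotient*m (L-step-∣ i)

Λ≢0 : ∀ i → NonZero (Λ i)
Λ≢0 i = quotient≢0 (L-step-∣ i) {{L≢0 (suc i)}}

L≡∏Λ : ∀ n → L n ≡ ∏ n Λ
L≡∏Λ zero    = L-0
L≡∏Λ (suc n) = trans (L-suc n) (trans (*-comm (Λ n) (L n)) (cong (_* Λ n) (L≡∏Λ n)))

∤⇒coprime : ∀ {p n} → Prime p → p ∤ n → Coprime p n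
∤⇒coprime pp p∤n (d∣p , d∣n) with prime⇒irreducible pp d∣p
... | inj₁ d≡1  = d≡1
... | inj₂ refl = contradiction d∣n p∤n

coprime-^ : ∀ {p n} k → Prime p → p ∤ n → Coprime (p ^ k) n
coprime-^ zero    pp p∤n (d∣1 , _) = ∣1⇒≡1 d∣1
coprime-^ {p} (suc k) pp p∤n {d} (d∣p*pᵏ , d∣n) =
  coprime-^ k pp p∤n (coprime-divisor d⊥p d∣p*pᵏ , d∣n)
  where
  d⊥p : Coprime d p
  d⊥p (e∣d , e∣p) = ∤⇒coprime pp p∤n (e∣p , ∣-trans e∣d d∣n)

-- With g = gcd m n, the cofactors m / g and n / g are coprime, so `p` misses one of them. As the
-- lcm is both (m / g) n and (n / g) m, the missed cofactor can be cancelled.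
prime^∣lcm : ∀ {p} k m n → .{{NonZero m}} → Prime p → p ^ k ∣ lcm m n → p ^ k ∣ m ⊎ p ^ k ∣ n
prime^∣lcm {p} k m n pp pᵏ∣lcm = split (p ∣? m′)
  where
  open ≡-Reasoning
  g = gcd m n
  instance
    g≢0 : NonZero g
    g≢0 = ≢-nonZero (gcd[m,n]≢0 m n (inj₁ (≢-nonZero⁻¹ m)))
  g∣m = gcd[m,n]∣m m n
  g∣n = gcd[m,n]∣n m n
  m′ = quotient g∣m
  n′ = quotient g∣n
  m′⊥n′ : Coprime m′ n′
  m′⊥n′ = subst₂ Coprime (n/m≡quotient g∣m) (n/m≡quotient g∣n) (coprime-/gcd m n)
  lcm≡m′n : lcm m n ≡ m′ * n
  lcm≡m′n = *-cancelˡ-≡ (lcm m n) (m′ * n) g (begin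
    g * lcm m n   ≡⟨ gcd*lcm m n ⟩
    m * n         ≡⟨ cong (_* n) (m∣n⇒n≡m*quotient g∣m) ⟩
    g * m′ * n    ≡⟨ *-assoc g m′ n ⟩
    g * (m′ * n)  ∎)
  lcm≡n′m : lcm m n ≡ n′ * m
  lcm≡n′m = *-cancelˡ-≡ (lcm m n) (n′ * m) g (begin
    g * lcm m n   ≡⟨ gcd*lcm m n ⟩
    m * n         ≡⟨ cong (m *_) (m∣n⇒n≡m*quotient g∣n) ⟩
    m * (g * n′)  ≡⟨ *-comm m (g * n′) ⟩
    g * n′ * m    ≡⟨ *-assoc g n′ m ⟩
    g * (n′ * m)  ∎)
  split : Dec (p ∣ m′) → p ^ k ∣ m ⊎ p ^ k ∣ n
  split (no p∤m′)  = inj₂ (coprime-divisor (coprime-^ k pp p∤m′) (subst (p ^ k ∣_) lcm≡m′n pᵏ∣lcm))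
  split (yes p∣m′) = inj₁ (coprime-divisor (coprime-^ k pp p∤n′) (subst (p ^ k ∣_) lcm≡n′m pᵏ∣lcm))
    where
    p∤n′ : p ∤ n′
    p∤n′ p∣n′ = contradiction (m′⊥n′ (p∣m′ , p∣n′)) (nonTrivial⇒≢1 {{prime⇒nonTrivial pp}})

-- By `prime^∣lcm` the prime power divides one of 1, ..., n. The exponent is `suc k` because `p ^ 0`
-- divides `L 0` but exceeds 0.
prime^∣L⇒≤ : ∀ {p} k n → Prime p → p ^ suc k ∣ L n → p ^ suc k ≤ n
prime^∣L⇒≤ {p} k zero pp pᵏ∣L = contradiction (m*n≡1⇒m≡1 p (p ^ k) (∣1⇒≡1 (subst (p ^ suc k ∣_) L-0 pᵏ∣L)))
  (nonTrivial⇒≢1 {{prime⇒nonTrivial pp}})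
prime^∣L⇒≤ {p} k (suc n) pp pᵏ∣L with prime^∣lcm (suc k) (suc n) (L n) pp (subst (p ^ suc k ∣_) (L-suc-lcm n) pᵏ∣L)
... | inj₁ pᵏ∣1+n = ∣⇒≤ pᵏ∣1+n
... | inj₂ pᵏ∣Ln  = m≤n⇒m≤1+n (prime^∣L⇒≤ k n pp pᵏ∣Ln)

Λ≡1 : ∀ {i} → suc i ∣ L i → Λ i ≡ 1
Λ≡1 {i} 1+i∣L = *-cancelʳ-≡ (Λ i) 1 (L i) {{L≢0 i}} (begin
  Λ i * L i        ≡⟨ L-suc i ⟨
  L (suc i)         ≡⟨ L-suc-lcm i ⟩
  lcm (suc i) (L i) ≡⟨ ∣-antisym (lcm-least 1+i∣L ∣-refl) (n∣lcm[m,n] (suc i) (L i)) ⟩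
  L i              ≡⟨ *-identityˡ (L i) ⟨
  1 * L i          ∎)
  where open ≡-Reasoning

-- Both factors occur among 1, ..., i; being coprime, their product already divides `L i`, so the
-- lcm does not grow.
Λ-coprime : ∀ {i a b} → Coprime a b → suc i ≡ a * b → a < suc i → b < suc i → Λ i ≡ 1
Λ-coprime {i} {zero}      {b}    a⊥b () a< b<
Λ-coprime {i} {a@(suc _)} {zero} a⊥b 1+i≡ a< b< with () ← trans 1+i≡ (*-zeroʳ a)
Λ-coprime {i} {a@(suc _)} {b@(suc _)} a⊥b 1+i≡ a< b< = Λ≡1 (subst (_∣ L i) (sym 1+i≡) ab∣L)
  where
  a∣L = ∣L {a} {i} (s≤s⁻¹ a<)
  L≡  = m∣n⇒n≡m*quotient a∣L
  ab∣L : a * b ∣ L i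
  ab∣L = subst (a * b ∣_) (sym L≡)
    (*-monoʳ-∣ a (coprime-divisor (Coprime.sym a⊥b) (subst (b ∣_) L≡ (∣L {b} {i} (s≤s⁻¹ b<)))))

-- Since `p ^ k` divides `L i`, the lcm grows by a divisor of `p`. Growth by 1 would mean that
-- `p ^ suc k` divides `L i`, against `prime^∣L⇒≤`.
Λ-prime^ : ∀ {i p} k → Prime p → suc i ≡ p ^ suc k → Λ i ≡ p
Λ-prime^ {i} {p} k pp 1+i≡ with prime⇒irreducible pp Λ∣p
  where
  instance _ = prime⇒nonZero pp
  instance _ = prime⇒nonTrivial pp
  instance _ = L≢0 i
  pᵏ∣L : p ^ k ∣ L i
  pᵏ∣L = ∣L {{m^n≢0 p k}} (s≤s⁻¹ (subst (p ^ k <_) (sym 1+i≡)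
    (^-monoʳ-< p (nonTrivial⇒n>1 p) (n<1+n k))))
  Λ∣p : Λ i ∣ p
  Λ∣p = *-cancelʳ-∣ (L i) (subst (_∣ p * L i) (L-suc i)
    (subst (_∣ p * L i) (sym (L-suc-lcm i)) (lcm-least (subst (_∣ p * L i) (sym 1+i≡) (*-monoʳ-∣ p pᵏ∣L)) (n∣m*n p))))
... | inj₂ Λ≡p  = Λ≡p
... | inj₁ Λ≡1′ = contradiction (prime^∣L⇒≤ k i pp pᵏ⁺¹∣L) (<⇒≱ (subst (i <_) 1+i≡ ≤-refl))
  where
  pᵏ⁺¹∣L : p ^ suc k ∣ L i
  pᵏ⁺¹∣L = subst₂ _∣_ 1+i≡ (trans (L-suc i) (trans (cong (_* L i) Λ≡1′) (*-identityˡ (L i))))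
             (∣L {suc i} ≤-refl)

ι : ∀ {P : Set} → Dec P → ℕ
ι (yes _) = 1
ι (no _)  = 0

ι-yes : ∀ {P : Set} (P? : Dec P) → P → ι P? ≡ 1
ι-yes (yes _) p = refl
ι-yes (no ¬p) p = contradiction p ¬p

ι-no : ∀ {P : Set} (P? : Dec P) → ¬ P → ι P? ≡ 0
ι-no (yes p) ¬p = contradiction p ¬p
ι-no (no _)  ¬p = refl

ι-cong : ∀ {P Q : Set} (P? : Dec P) (Q? : Dec Q) → (P → Q) → (Q → P) → ι P? ≡ ι Q?
ι-cong P? (yes q) P⇒Q Q⇒P = ι-yes P? (Q⇒P q)
ι-cong P? (no ¬q) P⇒Q Q⇒P = ι-no P? (¬q ∘ P⇒Q)

prime-split : ∀ {p} → Prime p → ∀ n → .{{NonZero n}} → ∃[ k ] ∃[ e ] n ≡ p ^ k * e × p ∤ e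
prime-split {p} pp n {{n≢0}} = <-rec P step n n≢0
  where
  instance _ = prime⇒nonTrivial pp
  P : ℕ → Set
  P n = .(NonZero n) → ∃[ k ] ∃[ e ] n ≡ p ^ k * e × p ∤ e
  step : ∀ n → (∀ {m} → m < n → P m) → P n
  step n rec n≢0 with p ∣? n
  ... | no p∤n  = 0 , n , sym (*-identityˡ n) , p∤n
  ... | yes p∣n with rec (quotient-< p∣n {{prime⇒nonTrivial pp}} {{n≢0}}) (quotient≢0 p∣n {{n≢0}})
  ...   | k , e , q≡ , p∤e = suc k , e
    , trans (m∣n⇒n≡m*quotient p∣n) (trans (cong (p *_) q≡) (sym (*-assoc p (p ^ k) e))) , p∤e

^-mono-∣ : ∀ p {j k} → j ≤ k → p ^ j ∣ p ^ k
^-mono-∣ p {j} {k} j≤k = divides (p ^ (k ∸ j))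
  (trans (cong (p ^_) (sym (m∸n+n≡m j≤k))) (^-distribˡ-+-* p (k ∸ j) j))

-- Passing from m = pᵛ e to p m creates only one new prime-power divisor, namely pᵛ⁺¹.
new-divisor : ∀ {p} → Prime p → ∀ v e → p ∤ e → ∀ i → suc i ∣ p * (p ^ v * e) →
              suc i ∣ p ^ v * e ⊎ Λ i ≡ 1 ⊎ suc i ≡ p ^ suc v
new-divisor {p} pp v e p∤e i d∣ with prime-split pp (suc i)
... | zero , b , d≡ , p∤b = inj₁ (coprime-divisor d⊥p d∣)
  where
  d⊥p : Coprime (suc i) p
  d⊥p = Coprime.sym (∤⇒coprime pp (subst (p ∤_) (sym (trans d≡ (*-identityˡ b))) p∤b))
... | suc k , b , d≡ , p∤b with b ≟ 1
...   | no b≢1 = inj₂ (inj₁ (Λ-coprime {i} {p ^ suc k} {b} (coprime-^ (suc k) pp p∤b) d≡ pᵏ<d b<d))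
  where
  instance
    _ = prime⇒nonTrivial pp
    p≢0 : NonZero p
    p≢0 = prime⇒nonZero pp
    pᵏ≢0 : NonZero (p ^ suc k)
    pᵏ≢0 = m^n≢0 p (suc k)
    b≢0 : NonZero b
    b≢0 = ≢-nonZero λ b≡0 → p∤b (subst (p ∣_) (sym b≡0) (p ∣0))
  1<b : 1 < b
  1<b = ≤∧≢⇒< (>-nonZero⁻¹ b) (b≢1 ∘ sym)
  pᵏ<d : p ^ suc k < suc i
  pᵏ<d = subst (p ^ suc k <_) (sym d≡) (m<m*n (p ^ suc k) b 1<b)
  1<pᵏ : 1 < p ^ suc k
  1<pᵏ = ^-monoʳ-< p (nonTrivial⇒n>1 p) {0} {suc k} z<s
  b<d : b < suc i
  b<d = subst (b <_) (trans (*-comm b (p ^ suc k)) (sym d≡)) (m<m*n b (p ^ suc k) 1<pᵏ)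
...   | yes refl with <-cmp k v
...     | tri< k<v _ _ = inj₁ (subst (_∣ p ^ v * e) (sym (trans d≡ (*-identityʳ _)))
                                     (∣m⇒∣m*n e (^-mono-∣ p k<v)))
...     | tri≈ _ refl _ = inj₂ (inj₂ (trans d≡ (*-identityʳ _)))
-- Here pᵛ⁺² would divide pᵛ⁺¹ e.
...     | tri> _ _ v<k = contradiction p∣e p∤e
  where
  instance
    p≢0 : NonZero p
    p≢0 = prime⇒nonZero pp
    pᵛ≢0 : NonZero (p ^ suc v)
    pᵛ≢0 = m^n≢0 p (suc v)
  p∣e : p ∣ e
  p∣e = *-cancelˡ-∣ (p ^ suc v) (subst₂ _∣_ (*-comm p (p ^ suc v)) (sym (*-assoc p (p ^ v) e))
    (∣-trans (^-mono-∣ p (s≤s v<k)) (subst (_∣ p * (p ^ v * e)) (trans d≡ (*-identityʳ _)) d∣)))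

-- By `new-divisor` the only divisor gained with `Λ` different from 1 is pᵛ⁺¹, where `Λ` equals `p`.
-- The common range `N` allows a comparison index by index.
∏Λ-∣-* : ∀ {p} → Prime p → ∀ m N → .{{NonZero m}} → p * m ≤ N →
         ∏ N (λ i → Λ i ^ ι (suc i ∣? p * m)) ≡ ∏ N (λ i → Λ i ^ ι (suc i ∣? m)) * p
∏Λ-∣-* {p} pp m N pm≤N with prime-split pp m
... | v , e , refl , p∤e = begin
  ∏ N (λ i → Λ i ^ ι (suc i ∣? p * m))                   ≡⟨ ∏-cong N (λ i _ → factor i) ⟩
  ∏ N (λ i → Λ i ^ ι (suc i ∣? m) * h i)                 ≡⟨ ∏-* N _ h ⟩
  ∏ N (λ i → Λ i ^ ι (suc i ∣? m)) * ∏ N h               ≡⟨ cong (∏ N (λ i → Λ i ^ ι (suc i ∣? m)) *_) ∏h ⟩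
  ∏ N (λ i → Λ i ^ ι (suc i ∣? m)) * p                   ∎
  where
  open ≡-Reasoning
  instance
    p≢0 : NonZero p
    p≢0 = prime⇒nonZero pp
    pᵛ≢0 : NonZero (p ^ suc v)
    pᵛ≢0 = m^n≢0 p (suc v)
    e≢0 : NonZero e
    e≢0 = ≢-nonZero λ e≡0 → p∤e (subst (p ∣_) (sym e≡0) (p ∣0))
  h : ℕ → ℕ
  h i = p ^ ι (suc i ≟ p ^ suc v)
  c = pred (p ^ suc v)
  1+c≡ : suc c ≡ p ^ suc v
  1+c≡ = suc-pred (p ^ suc v)
  pᵛ⁺¹∣pm : p ^ suc v ∣ p * m
  pᵛ⁺¹∣pm = *-monoʳ-∣ p (m∣m*n e)
  ∏h : ∏ N h ≡ p
  ∏h = trans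
    (∏-single N c
      (≤-trans (≤-reflexive 1+c≡) (≤-trans (∣⇒≤ {{m*n≢0 p m}} pᵛ⁺¹∣pm) pm≤N))
      (λ i _ i≢c → cong (p ^_) (ι-no (suc i ≟ p ^ suc v)
        (λ 1+i≡ → i≢c (suc-injective (trans 1+i≡ (sym 1+c≡)))))))
    (trans (cong (p ^_) (ι-yes (suc c ≟ p ^ suc v) 1+c≡)) (*-identityʳ p))
  factor : ∀ i → Λ i ^ ι (suc i ∣? p * m) ≡ Λ i ^ ι (suc i ∣? m) * h i
  factor i with suc i ≟ p ^ suc v
  ... | yes 1+i≡ = begin
    Λ i ^ ι (suc i ∣? p * m)       ≡⟨ cong (Λ i ^_) (ι-yes (suc i ∣? p * m) (subst (_∣ p * m) (sym 1+i≡) pᵛ⁺¹∣pm)) ⟩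
    Λ i ^ 1                        ≡⟨ cong (_^ 1) (Λ-prime^ v pp 1+i≡) ⟩
    p ^ 1                          ≡⟨ *-identityˡ (p ^ 1) ⟨
    Λ i ^ 0 * p ^ 1                ≡⟨ cong (λ k → Λ i ^ k * p ^ 1) (ι-no (suc i ∣? m) 1+i∤m) ⟨
    Λ i ^ ι (suc i ∣? m) * p ^ 1   ∎
    where
    1+i∤m : suc i ∤ m
    1+i∤m 1+i∣m = p∤e (*-cancelˡ-∣ (p ^ v) {{m^n≢0 p v}}
      (subst (_∣ p ^ v * e) (trans 1+i≡ (*-comm p (p ^ v))) 1+i∣m))
  ... | no 1+i≢ with suc i ∣? p * m | suc i ∣? m
  ...   | yes _  | yes _ = sym (*-identityʳ (Λ i ^ 1))
  ...   | no _   | no _  = refl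
  ...   | no ∤pm | yes ∣m = contradiction (∣n⇒∣m*n p ∣m) ∤pm
  ...   | yes ∣pm | no ∤m with new-divisor pp v e p∤e i ∣pm
  ...     | inj₁ ∣m          = contradiction ∣m ∤m
  ...     | inj₂ (inj₁ Λ≡1′) = cong (_* 1) Λ≡1′
  ...     | inj₂ (inj₂ 1+i≡) = contradiction 1+i≡ 1+i≢

∏Λ-∣-1 : ∀ N → ∏ N (λ i → Λ i ^ ι (suc i ∣? 1)) ≡ 1
∏Λ-∣-1 N = ∏-1 N λ where
  zero    _ → cong (_^ 1) (Λ≡1 (1∣ L 0))
  (suc i) _ → cong (Λ (suc i) ^_) (ι-no (2+ i ∣? 1) (λ d∣1 → contradiction (∣1⇒≡1 d∣1) λ ()))

∏Λ-∣-product : ∀ {ps} → All Prime ps → ∀ N → product ps ≤ N →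
               ∏ N (λ i → Λ i ^ ι (suc i ∣? product ps)) ≡ product ps
∏Λ-∣-product [] N _ = ∏Λ-∣-1 N
∏Λ-∣-product {p ∷ ps} (pp ∷ pps) N pΠ≤N =
  trans (∏Λ-∣-* pp (product ps) N {{productOfPrimes≢0 pps}} pΠ≤N)
  (trans (cong (_* p) (∏Λ-∣-product pps N
           (≤-trans (m≤n*m (product ps) p {{prime⇒nonZero pp}}) pΠ≤N)))
         (*-comm (product ps) p))

-- The multiplicative form of Σ Λ(d) = log n over the divisors d of n.
∏Λ-∣ : ∀ n N → .{{NonZero n}} → n ≤ N → ∏ N (λ i → Λ i ^ ι (suc i ∣? n)) ≡ n
∏Λ-∣ n N n≤N = subst (λ k → ∏ N (λ i → Λ i ^ ι (suc i ∣? k)) ≡ k) (sym isFactorisation)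
  (∏Λ-∣-product factorsPrime N (subst (_≤ N) isFactorisation n≤N))
  where open PrimeFactorisation (factorise n)

-- The exponential of the sum of f weighted by von Mangoldt's function. It is monotone and turns
-- sums into products, hence carries a pointwise inequality between floor functions to one between
-- integers.
V : ℕ → (ℕ → ℕ) → ℕ
V N f = ∏ N (λ i → Λ i ^ f i)

V-cong : ∀ N {f g} → (∀ i → i < N → f i ≡ g i) → V N f ≡ V N g
V-cong N f≗g = ∏-cong N λ i i<N → cong (Λ i ^_) (f≗g i i<N)

V-mono-≤ : ∀ N {f g} → (∀ i → i < N → f i ≤ g i) → V N f ≤ V N g
V-mono-≤ N f≤g = ∏-mono-≤ N λ i i<N → ^-monoʳ-≤ (Λ i) {{Λ≢0 i}} (f≤g i i<N)

V-+ : ∀ N f g → V N (λ i → f i + g i) ≡ V N f * V N g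
V-+ N f g = trans (∏-cong N λ i _ → ^-distribˡ-+-* (Λ i) (f i) (g i))
                  (∏-* N (λ i → Λ i ^ f i) (λ i → Λ i ^ g i))

V-0 : ∀ N → V N (λ _ → 0) ≡ 1
V-0 N = ∏-1 N λ _ _ → refl

suc-/ : ∀ n d → .{{_ : NonZero d}} → suc n / d ≡ ι (d ∣? suc n) + n / d
suc-/ n d with d ∣? suc n
... | yes d∣1+n = *-cancelʳ-≡ (suc n / d) (suc (n / d)) d (≤-antisym
        lower upper)
  where
  q = suc n / d
  q*d≡ : q * d ≡ suc n
  q*d≡ = m/n*n≡m d∣1+n
  upper : suc (n / d) * d ≤ q * d
  upper = *-monoˡ-≤ d (m<n*o⇒m/o<n {n} {q} {d} (≤-reflexive (sym q*d≡)))
  lower : q * d ≤ suc (n / d) * d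
  lower = subst (_≤ suc (n / d) * d) (sym q*d≡)
    (subst (_< suc (n / d) * d) (sym (m≡m%n+[m/n]*n n d)) (+-monoˡ-< ((n / d) * d) (m%n<n n d)))
... | no d∤1+n = ≤-antisym
        (s≤s⁻¹ (m<n*o⇒m/o<n {suc n} {suc (n / d)} {d} (≤∧≢⇒< 1+n≤ λ eq → d∤1+n (divides (suc (n / d)) eq))))
        (/-monoˡ-≤ d (n≤1+n n))
  where
  1+n≤ : suc n ≤ suc (n / d) * d
  1+n≤ = subst (_< suc (n / d) * d) (sym (m≡m%n+[m/n]*n n d)) (+-monoˡ-< ((n / d) * d) (m%n<n n d))

-- From n to n + 1 the quotient ⌊n/q⌋ rises by 1 exactly when q divides n + 1, and these q
-- contribute the factor n + 1 by `∏Λ-∣`.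
V-! : ∀ n N → n ≤ N → V N (λ i → n / suc i) ≡ n !
V-! zero    N _    = trans (V-cong N λ i _ → 0/n≡0 (suc i)) (V-0 N)
V-! (suc n) N n<N = begin
  V N (λ i → suc n / suc i)                              ≡⟨ V-cong N (λ i _ → suc-/ n (suc i)) ⟩
  V N (λ i → ι (suc i ∣? suc n) + n / suc i)             ≡⟨ V-+ N (λ i → ι (suc i ∣? suc n)) (λ i → n / suc i) ⟩
  V N (λ i → ι (suc i ∣? suc n)) * V N (λ i → n / suc i) ≡⟨ cong₂ _*_ (∏Λ-∣ (suc n) N n<N) (V-! n N (<⇒≤ n<N)) ⟩
  suc n * n !                                            ∎
  where open ≡-Reasoning

V-L : ∀ n N → n ≤ N → V N (λ i → ι (suc i ≤? n)) ≡ L n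
V-L n zero    z≤n   = sym L-0
V-L n (suc N) n≤1+N with m≤n⇒m<n∨m≡n n≤1+N
... | inj₁ n<1+N = trans (cong₂ _*_ (V-L n N (s≤s⁻¹ n<1+N))
                                    (cong (Λ N ^_) (ι-no (suc N ≤? n) (<⇒≱ n<1+N))))
                         (*-identityʳ (L n))
... | inj₂ refl = trans (∏-cong n λ i i<n → trans (cong (Λ i ^_) (ι-yes (suc i ≤? n) i<n)) (*-identityʳ (Λ i)))
                        (sym (L≡∏Λ n))

-- Bounds on factorials

/-superadditive : ∀ a b q → .{{_ : NonZero q}} → a / q + b / q ≤ (a + b) / q
/-superadditive a b q = begin
  a / q + b / q                  ≡⟨ m*n/n≡m (a / q + b / q) q ⟨
  (a / q + b / q) * q / q        ≡⟨ cong (_/ q) (*-distribʳ-+ q (a / q) (b / q)) ⟩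
  (a / q * q + b / q * q) / q    ≤⟨ /-monoˡ-≤ q (+-mono-≤ (m/n*n≤m a q) (m/n*n≤m b q)) ⟩
  (a + b) / q                    ∎
  where open ≤-Reasoning

-- The exponential of ψ(a + b) - ψ(b) ≤ log of the binomial coefficient. For b < q ≤ a + b both
-- ⌊a/q⌋ and ⌊b/q⌋ vanish while ⌊(a + b)/q⌋ is positive; for q ≤ b superadditivity of the floor
-- suffices.
L-+ : ∀ {a b} → a ≤ b → L (a + b) * (a ! * b !) ≤ (a + b) ! * L b
L-+ {a} {b} a≤b = begin
  L N * (a ! * b !)                    ≡⟨ cong₂ _*_ (V-L N N ≤-refl) (cong₂ _*_ (V-! a N (m≤m+n a b)) (V-! b N (m≤n+m b a))) ⟨
  V N l * (V N f * V N g)              ≡⟨ cong (V N l *_) (V-+ N f g) ⟨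
  V N l * V N (λ i → f i + g i)        ≡⟨ V-+ N l (λ i → f i + g i) ⟨
  V N (λ i → l i + (f i + g i))        ≤⟨ V-mono-≤ N pointwise ⟩
  V N (λ i → N / suc i + h i)          ≡⟨ V-+ N (λ i → N / suc i) h ⟩
  V N (λ i → N / suc i) * V N h        ≡⟨ cong₂ _*_ (V-! N N ≤-refl) (V-L b N (m≤n+m b a)) ⟩
  N ! * L b                            ∎
  where
  open ≤-Reasoning
  N = a + b
  l f g h : ℕ → ℕ
  l i = ι (suc i ≤? N)
  f i = a / suc i
  g i = b / suc i
  h i = ι (suc i ≤? b)
  pointwise : ∀ i → i < N → l i + (f i + g i) ≤ N / suc i + h i
  pointwise i i<N with suc i ≤? N | suc i ≤? b
  ... | no ≰N | _ = contradiction i<N ≰N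
  ... | yes _ | yes _ = subst (suc (f i + g i) ≤_) (+-comm 1 (N / suc i)) (s≤s (/-superadditive a b (suc i)))
  ... | yes q≤N | no q≰b = begin
    1 + (a / suc i + b / suc i)  ≡⟨ cong₂ (λ x y → 1 + (x + y)) (m<n⇒m/n≡0 (≤-<-trans a≤b (≰⇒> q≰b))) (m<n⇒m/n≡0 (≰⇒> q≰b)) ⟩
    1                            ≤⟨ m≥n⇒m/n>0 q≤N ⟩
    N / suc i                    ≡⟨ +-identityʳ (N / suc i) ⟨
    N / suc i + 0                ∎

[m+m]!≤ : ∀ m → (m + m) ! ≤ 4 ^ m * (m ! * m !)
[m+m]!≤ zero    = ≤-refl
[m+m]!≤ (suc m) = begin
  (suc m + suc m) !                               ≡⟨ cong (λ k → suc k !) (+-suc m m) ⟩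
  (2+ (m + m)) * (suc (m + m) * (m + m) !)        ≡⟨ *-assoc (2+ (m + m)) (suc (m + m)) ((m + m) !) ⟨
  (2+ (m + m)) * suc (m + m) * (m + m) !          ≤⟨ *-mono-≤ ineq ([m+m]!≤ m) ⟩
  4 * (suc m * suc m) * (4 ^ m * (m ! * m !))     ≡⟨ rearrange (4 ^ m) (m !) m ⟩
  4 * 4 ^ m * (suc m * m ! * (suc m * m !))       ∎
  where
  open ≤-Reasoning
  rearrange : ∀ x y m → 4 * (suc m * suc m) * (x * (y * y)) ≡ 4 * x * (suc m * y * (suc m * y))
  rearrange = solve-∀
  expand : ∀ m → 2+ (m + m) * suc (m + m) + (2 + 2 * m) ≡ 4 * (suc m * suc m)
  expand = solve-∀
  ineq : 2+ (m + m) * suc (m + m) ≤ 4 * (suc m * suc m)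
  ineq = ≤-trans (m≤m+n _ (2 + 2 * m)) (≤-reflexive (expand m))

[m+1+m]!≤ : ∀ m → (m + suc m) ! ≤ 4 ^ m * (m ! * suc m !)
[m+1+m]!≤ zero    = ≤-refl
[m+1+m]!≤ (suc m) = begin
  suc (m + 2+ m) !                                              ≡⟨ cong (λ k → suc k !) (+-suc m (suc m)) ⟩
  (2+ (m + suc m)) * (suc (m + suc m) * (m + suc m) !)          ≡⟨ *-assoc (2+ (m + suc m)) (suc (m + suc m)) ((m + suc m) !) ⟨
  (2+ (m + suc m)) * suc (m + suc m) * (m + suc m) !            ≤⟨ *-mono-≤ ineq ([m+1+m]!≤ m) ⟩
  4 * (suc m * 2+ m) * (4 ^ m * (m ! * suc m !))                ≡⟨ rearrange (4 ^ m) (m !) (suc m !) m ⟩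
  4 * 4 ^ m * (suc m * m ! * (2+ m * suc m !))                  ∎
  where
  open ≤-Reasoning
  rearrange : ∀ x y z m → 4 * (suc m * 2+ m) * (x * (y * z)) ≡ 4 * x * (suc m * y * (2+ m * z))
  rearrange = solve-∀
  expand : ∀ m → 2+ (m + suc m) * suc (m + suc m) + (2 + 2 * m) ≡ 4 * (suc m * 2+ m)
  expand = solve-∀
  ineq : 2+ (m + suc m) * suc (m + suc m) ≤ 4 * (suc m * 2+ m)
  ineq = ≤-trans (m≤m+n _ (2 + 2 * m)) (≤-reflexive (expand m))

even-or-odd : ∀ n → ∃[ m ] (n ≡ m + m ⊎ n ≡ m + suc m)
even-or-odd zero = 0 , inj₁ refl
even-or-odd (suc n) with even-or-odd n
... | m , inj₁ n≡ = m , inj₂ (trans (cong suc n≡) (sym (+-suc m m)))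
... | m , inj₂ n≡ = suc m , inj₁ (cong suc n≡)

L≤4^ : ∀ n → L n ≤ 4 ^ n
L≤4^ = <-rec (λ n → L n ≤ 4 ^ n) step
  where
  open ≤-Reasoning
  bound : ∀ a b → a ≤ b → (a + b) ! ≤ 4 ^ a * (a ! * b !) → L b ≤ 4 ^ b → L (a + b) ≤ 4 ^ (a + b)
  bound a b a≤b !≤ Lb≤ = *-cancelʳ-≤ (L (a + b)) (4 ^ (a + b)) (a ! * b !) {{a !* b !≢0}} (begin
    L (a + b) * (a ! * b !)           ≤⟨ L-+ a≤b ⟩
    (a + b) ! * L b                   ≤⟨ *-mono-≤ !≤ Lb≤ ⟩
    4 ^ a * (a ! * b !) * 4 ^ b       ≡⟨ rearrange (4 ^ a) (a ! * b !) (4 ^ b) ⟩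
    4 ^ a * 4 ^ b * (a ! * b !)       ≡⟨ cong (_* (a ! * b !)) (^-distribˡ-+-* 4 a b) ⟨
    4 ^ (a + b) * (a ! * b !)         ∎)
    where
    rearrange : ∀ x y z → x * y * z ≡ x * z * y
    rearrange = solve-∀
  step : ∀ n → (∀ {m} → m < n → L m ≤ 4 ^ m) → L n ≤ 4 ^ n
  step n rec with even-or-odd n
  -- For n ≤ 1 the larger half is n itself, so there is no smaller case to recur to.
  ... | zero  , inj₁ refl = ≤-reflexive L-0
  ... | suc m , inj₁ refl = bound (suc m) (suc m) ≤-refl ([m+m]!≤ (suc m)) (rec (m<m+n (suc m) z<s))
  ... | zero  , inj₂ refl = ≤-trans (≤-reflexive L-1) (s≤s z≤n)
  ... | suc m , inj₂ refl = bound (suc m) (2+ m) (n≤1+n (suc m)) ([m+1+m]!≤ (suc m)) (rec (m<n+m (2+ m) z<s))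

-- Convexity, AM-GM and Stirling's approximation.

rearrangement : ∀ {a b} n → a ≤ b → a * b ^ n + a ^ n * b ≤ a ^ suc n + b ^ suc n
rearrangement {a} {b} n a≤b with m≤n⇒∃[o]m+o≡n a≤b
... | d , refl = begin
  a * b ^ n + a ^ n * (a + d)        ≡⟨ eq₁ a d (a ^ n) (b ^ n) ⟩
  a * a ^ n + a * b ^ n + d * a ^ n  ≤⟨ +-monoʳ-≤ (a * a ^ n + a * b ^ n) (*-monoʳ-≤ d (^-monoˡ-≤ n a≤b)) ⟩
  a * a ^ n + a * b ^ n + d * b ^ n  ≡⟨ eq₂ a d (a ^ n) (b ^ n) ⟩
  a * a ^ n + (a + d) * b ^ n        ∎
  where
  open ≤-Reasoning
  eq₁ : ∀ a d x y → a * y + x * (a + d) ≡ a * x + a * y + d * x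
  eq₁ = solve-∀
  eq₂ : ∀ a d x y → a * x + a * y + d * y ≡ a * x + (a + d) * y
  eq₂ = solve-∀

-- The graph of x ↦ xⁿ⁺¹ lies above its tangent at b, with the negative term moved across.
tangent : ∀ a b n → suc n * a * b ^ n ≤ a ^ suc n + n * b ^ suc n
tangent a b zero    = ≤-reflexive (eq a)
  where
  eq : ∀ a → 1 * a * 1 ≡ a * 1 + 0
  eq = solve-∀
tangent a b (suc n) = begin
  2+ n * a * (b * b ^ n)                                   ≡⟨ eq₁ a b n (b ^ n) ⟩
  b * (suc n * a * b ^ n) + a * b ^ suc n                  ≤⟨ +-monoˡ-≤ (a * b ^ suc n) (*-monoʳ-≤ b (tangent a b n)) ⟩
  b * (a ^ suc n + n * b ^ suc n) + a * b ^ suc n          ≡⟨ eq₂ a b n (a ^ suc n) (b ^ suc n) ⟩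
  a * b ^ suc n + a ^ suc n * b + n * (b * b ^ suc n)      ≤⟨ +-monoˡ-≤ (n * (b * b ^ suc n)) swap ⟩
  a ^ 2+ n + b ^ 2+ n + n * (b * b ^ suc n)                ≡⟨ +-assoc (a ^ 2+ n) (b ^ 2+ n) _ ⟩
  a ^ 2+ n + suc n * b ^ 2+ n                              ∎
  where
  open ≤-Reasoning
  eq₁ : ∀ a b n x → 2+ n * a * (b * x) ≡ b * (suc n * a * x) + a * (b * x)
  eq₁ = solve-∀
  eq₂ : ∀ a b n x y → b * (x + n * y) + a * y ≡ a * y + x * b + n * (b * y)
  eq₂ = solve-∀
  swap : a * b ^ suc n + a ^ suc n * b ≤ a ^ 2+ n + b ^ 2+ n
  swap with ≤-total a b
  ... | inj₁ a≤b = rearrangement (suc n) a≤b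
  ... | inj₂ b≤a = begin
    a * b ^ suc n + a ^ suc n * b ≡⟨ +-comm (a * b ^ suc n) _ ⟩
    a ^ suc n * b + a * b ^ suc n ≡⟨ cong₂ _+_ (*-comm (a ^ suc n) b) (*-comm a (b ^ suc n)) ⟩
    b * a ^ suc n + b ^ suc n * a ≤⟨ rearrangement (suc n) b≤a ⟩
    b ^ 2+ n + a ^ 2+ n           ≡⟨ +-comm (b ^ 2+ n) _ ⟩
    a ^ 2+ n + b ^ 2+ n           ∎

^-distribʳ-* : ∀ n a b → (a * b) ^ n ≡ a ^ n * b ^ n
^-distribʳ-* zero    a b = refl
^-distribʳ-* (suc n) a b = trans (cong (a * b *_) (^-distribʳ-* n a b))
                                 ([m*n]*[o*p]≡[m*o]*[n*p] a b (a ^ n) (b ^ n))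

-- The tangent inequality at b = (n + 1) x, evaluated at a = n x + y.
am-gm : ∀ x y n → suc n ^ suc n * (x ^ n * y) ≤ (n * x + y) ^ suc n
am-gm x y n = +-cancelʳ-≤ (n * b ^ suc n) _ _ (begin
  suc n ^ suc n * (x ^ n * y) + n * b ^ suc n        ≡⟨ eq x y n (suc n ^ n) (x ^ n) (b ^ n) (^-distribʳ-* n (suc n) x) ⟩
  suc n * a * b ^ n                                  ≤⟨ tangent a b n ⟩
  a ^ suc n + n * b ^ suc n                          ∎)
  where
  open ≤-Reasoning
  a = n * x + y
  b = suc n * x
  eq : ∀ x y n s t u → u ≡ s * t →
       suc n * s * (t * y) + n * (suc n * x * u) ≡ suc n * (n * x + y) * u
  eq x y n s t u refl = eq′ x y n s t
    where
    eq′ : ∀ x y n s t → suc n * s * (t * y) + n * (suc n * x * (s * t)) ≡ suc n * (n * x + y) * (s * t)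
    eq′ = solve-∀

-- (1 + 1/n)ⁿ increases and (1 + 1/n)ⁿ⁺¹ decreases; denominators are cleared throughout.

up-step : ∀ n → suc n ^ n * suc n ^ suc n ≤ n ^ n * 2+ n ^ suc n
up-step zero = s≤s z≤n
up-step n@(suc _) = *-cancelʳ-≤ _ _ n (begin
  suc n ^ n * suc n ^ suc n * n         ≡⟨ eq₁ (suc n ^ n) (suc n ^ suc n) n ⟩
  -- n copies of n + 1 and one n have sum n (n + 2).
  suc n ^ suc n * (suc n ^ n * n)       ≤⟨ am-gm (suc n) n n ⟩
  (n * suc n + n) ^ suc n               ≡⟨ cong (_^ suc n) (eq₂ n) ⟩
  (n * 2+ n) ^ suc n                    ≡⟨ ^-distribʳ-* (suc n) n (2+ n) ⟩
  n * n ^ n * 2+ n ^ suc n              ≡⟨ eq₃ (n ^ n) (2+ n ^ suc n) n ⟩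
  n ^ n * 2+ n ^ suc n * n              ∎)
  where
  open ≤-Reasoning
  eq₁ : ∀ x y n → x * y * n ≡ y * (x * n)
  eq₁ = solve-∀
  eq₂ : ∀ n → n * suc n + n ≡ n * 2+ n
  eq₂ = solve-∀
  eq₃ : ∀ x y n → n * x * y ≡ x * y * n
  eq₃ = solve-∀

down-step : ∀ n → 2+ n ^ 2+ n * n ^ suc n ≤ suc n ^ suc n * suc n ^ 2+ n
down-step n = *-cancelʳ-≤ _ _ (suc n) (begin
  2+ n ^ 2+ n * n ^ suc n * suc n       ≡⟨ *-assoc (2+ n ^ 2+ n) (n ^ suc n) (suc n) ⟩
  -- n + 1 copies of n and one n + 1 have sum (n + 1)².
  2+ n ^ 2+ n * (n ^ suc n * suc n)     ≤⟨ am-gm n (suc n) (suc n) ⟩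
  (suc n * n + suc n) ^ 2+ n            ≡⟨ cong (_^ 2+ n) (eq₁ n) ⟩
  (suc n * suc n) ^ 2+ n                ≡⟨ ^-distribʳ-* (2+ n) (suc n) (suc n) ⟩
  suc n ^ 2+ n * suc n ^ 2+ n           ≡⟨ eq₂ (suc n) (suc n ^ suc n) (suc n ^ 2+ n) ⟩
  suc n ^ suc n * suc n ^ 2+ n * suc n  ∎)
  where
  open ≤-Reasoning
  eq₁ : ∀ n → suc n * n + suc n ≡ suc n * suc n
  eq₁ = solve-∀
  eq₂ : ∀ k x y → k * x * y ≡ x * y * k
  eq₂ = solve-∀

-- Transitivity of a/b ≤ c/d ≤ e/f, cross-multiplied.
≤-ratio-trans : ∀ {a b c d e f} → .{{NonZero c}} → .{{NonZero d}} →
                a * d ≤ b * c → c * f ≤ d * e → a * f ≤ b * e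
≤-ratio-trans {a} {b} {c} {d} {e} {f} ad≤bc cf≤de = *-cancelʳ-≤ (a * f) (b * e) (d * c) {{m*n≢0 d c}} (begin
  a * f * (d * c)     ≡⟨ eq₁ a f d c ⟩
  a * d * (c * f)     ≤⟨ *-mono-≤ ad≤bc cf≤de ⟩
  b * c * (d * e)     ≡⟨ eq₂ b c d e ⟩
  b * e * (d * c)     ∎)
  where
  open ≤-Reasoning
  eq₁ : ∀ a f d c → a * f * (d * c) ≡ a * d * (c * f)
  eq₁ = solve-∀
  eq₂ : ∀ b c d e → b * c * (d * e) ≡ b * e * (d * c)
  eq₂ = solve-∀

up-mono : ∀ {k J} → k ≤ J → suc k ^ k * J ^ J ≤ k ^ k * suc J ^ J
up-mono {k} {zero} z≤n = ≤-refl
up-mono {k} {suc J} k≤1+J with m≤n⇒m<n∨m≡n k≤1+J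
... | inj₂ refl  = ≤-reflexive (*-comm (suc k ^ k) (k ^ k))
... | inj₁ k<1+J = ≤-ratio-trans {suc k ^ k} {k ^ k} {suc J ^ J} {J ^ J} {2+ J ^ suc J} {suc J ^ suc J}
  {{m^n≢0 (suc J) J}} {{J^J≢0 J}} (up-mono (s≤s⁻¹ k<1+J)) (up-step J)
  where
  J^J≢0 : ∀ J → NonZero (J ^ J)
  J^J≢0 zero    = _
  J^J≢0 (suc J) = m^n≢0 (suc J) (suc J)

down-mono : ∀ {k J} → k ≤ J → suc J ^ suc J * k ^ suc k ≤ J ^ suc J * suc k ^ suc k
down-mono {k} {zero} z≤n = ≤-refl
down-mono {zero} {suc J} _ = ≤-trans (≤-reflexive (*-zeroʳ (2+ J ^ 2+ J))) z≤n
down-mono {k@(suc _)} {suc J} k≤1+J with m≤n⇒m<n∨m≡n k≤1+J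
... | inj₂ refl  = ≤-reflexive (*-comm (suc k ^ suc k) (k ^ suc k))
... | inj₁ k<1+J with s≤s⁻¹ k<1+J
...   | k≤J@(s≤s _) = ≤-ratio-trans {2+ J ^ 2+ J} {suc J ^ 2+ J} {suc J ^ suc J} {J ^ suc J} {suc k ^ suc k} {k ^ suc k}
  {{m^n≢0 (suc J) (suc J)}} {{m^n≢0 J (suc J)}}
  (≤-trans (down-step J) (≤-reflexive (*-comm (suc J ^ suc J) (suc J ^ 2+ J))))
  (down-mono k≤J)

up≤down : ∀ {k J} → k ≤ J → suc J ^ J * k ^ suc k ≤ J ^ J * suc k ^ suc k
up≤down {k} {zero} z≤n = z≤n
up≤down {k} {J@(suc _)} k≤J = ≤-ratio-trans {suc J ^ J} {J ^ J} {suc J ^ suc J} {J ^ suc J} {suc k ^ suc k} {k ^ suc k}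
  {{m^n≢0 (suc J) (suc J)}} {{m^n≢0 J (suc J)}} diagonal (down-mono k≤J)
  where
  open ≤-Reasoning
  eq₁ : ∀ x y J → x * (J * y) ≡ y * (J * x)
  eq₁ = solve-∀
  diagonal : suc J ^ J * J ^ suc J ≤ J ^ J * suc J ^ suc J
  diagonal = begin
    suc J ^ J * (J * J ^ J)       ≡⟨ eq₁ (suc J ^ J) (J ^ J) J ⟩
    J ^ J * (J * suc J ^ J)       ≤⟨ *-monoʳ-≤ (J ^ J) (*-monoˡ-≤ (suc J ^ J) (n≤1+n J)) ⟩
    J ^ J * (suc J * suc J ^ J)   ∎

-- Stirling's approximation with (1 + 1/J)^J in place of e: it cancels from balanced quotients of
-- factorials, so that no numerical value of e is needed.
module Stirling (J : ℕ) where

  E F : ℕ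
  E = suc J ^ J
  F = J ^ J

  -- Telescopes (1 + 1/n)ⁿ ≤ E / F, which holds as long as n stays below J.
  !-lower : ∀ n → n ≤ J → n ^ n * F ^ n ≤ n ! * E ^ n
  !-lower zero    _   = ≤-refl
  !-lower (suc n) n<J = *-cancelʳ-≤ _ _ (n ^ n) {{n^n≢0 n}} (begin
    suc n ^ suc n * (F * F ^ n) * n ^ n             ≡⟨ eq₁ n (suc n ^ n) F (F ^ n) (n ^ n) ⟩
    suc n * (suc n ^ n * F) * (n ^ n * F ^ n)       ≤⟨ *-mono-≤ (*-monoʳ-≤ (suc n) (up-mono {n} {J} (<⇒≤ n<J))) (!-lower n (<⇒≤ n<J)) ⟩
    suc n * (n ^ n * E) * (n ! * E ^ n)             ≡⟨ eq₂ n (n ^ n) E (n !) (E ^ n) ⟩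
    suc n ! * (E * E ^ n) * n ^ n                   ∎)
    where
    open ≤-Reasoning
    n^n≢0 : ∀ n → NonZero (n ^ n)
    n^n≢0 zero    = _
    n^n≢0 (suc n) = m^n≢0 (suc n) (suc n)
    eq₁ : ∀ n a f g x → suc n * a * (f * g) * x ≡ suc n * (a * f) * (x * g)
    eq₁ = solve-∀
    eq₂ : ∀ n x e y g → suc n * (x * e) * (y * g) ≡ suc n * y * (e * g) * x
    eq₂ = solve-∀

  -- Telescopes E / F ≤ (1 + 1/n)ⁿ⁺¹, whose extra exponent produces the factor `n`. The 4 is (1 +
  -- 1/1)², the bound on E / F at n = 1.
  !-upper : ∀ n → .{{NonZero n}} → n ≤ J → n ! * E ^ n ≤ 4 * n * (n ^ n * F ^ n)
  !-upper 1 1≤J = begin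
    1 * (E * 1)                ≡⟨ eq E ⟩
    E * (1 ^ 2)                ≤⟨ up≤down 1≤J ⟩
    F * 4                      ≡⟨ *-comm F 4 ⟩
    4 * F                      ≡⟨ eq′ F ⟩
    4 * 1 * (1 ^ 1 * F ^ 1)    ∎
    where
    open ≤-Reasoning
    eq : ∀ e → 1 * (e * 1) ≡ e * 1
    eq = solve-∀
    eq′ : ∀ f → 4 * f ≡ 4 * (f * 1 + 0)
    eq′ = solve-∀
  !-upper (suc n@(suc _)) n<J = begin
    suc n ! * (E * E ^ n)                           ≡⟨ eq₁ n (n !) E (E ^ n) ⟩
    suc n * E * (n ! * E ^ n)                       ≤⟨ *-monoʳ-≤ (suc n * E) (!-upper n (<⇒≤ n<J)) ⟩
    suc n * E * (4 * n * (n ^ n * F ^ n))           ≡⟨ eq₂ n E (n ^ n) (F ^ n) ⟩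
    4 * suc n * (E * n ^ suc n * F ^ n)             ≤⟨ *-monoʳ-≤ (4 * suc n) (*-monoˡ-≤ (F ^ n) (up≤down (<⇒≤ n<J))) ⟩
    4 * suc n * (F * suc n ^ suc n * F ^ n)         ≡⟨ eq₃ n F (suc n ^ suc n) (F ^ n) ⟩
    4 * suc n * (suc n ^ suc n * F ^ suc n)         ∎
    where
    open ≤-Reasoning
    eq₁ : ∀ n x e g → suc n * x * (e * g) ≡ suc n * e * (x * g)
    eq₁ = solve-∀
    eq₂ : ∀ n e x g → suc n * e * (4 * n * (x * g)) ≡ 4 * suc n * (e * (n * x) * g)
    eq₂ = solve-∀
    eq₃ : ∀ n f y g → 4 * suc n * (f * y * g) ≡ 4 * suc n * (y * (f * g))
    eq₃ = solve-∀

-- Balanced inequalities between floor functions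

-- n / k for k > 0; the junk value n ÷ 0 = n never occurs.
infixl 7 _÷_
_÷_ : ℕ → ℕ → ℕ
n ÷ k = n / suc (pred k)

-- A divisor d of 210 is represented by the cofactor c = 210 / d, so that ⌊ Y / d ⌋ = ⌊ c Y / 210 ⌋.
floors : List ℕ → ℕ → ℕ
floors cs Y = sum (map (λ c → c * Y / 210) cs)

steps : List ℕ → ℕ → ℕ
steps ks Y = sum (map (λ k → ι (k ≤? Y)) ks)

factorials : List ℕ → ℕ → ℕ
factorials cs m = product (map (λ c → (c * m) !) cs)

Ψ : ℕ → List ℕ → ℕ
Ψ X ks = product (map (λ k → L (X ÷ k)) ks)

-- The product of the (c m)^(c m) is `selfPowers cs ^ m` times a power of m that depends on `cs`
-- only through its sum; so this is the part of Stirling's main term that survives in a balanced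
-- quotient.
selfPowers : List ℕ → ℕ
selfPowers cs = product (map (λ c → c ^ c) cs)

-- With d = 210 / c and X = 210 m, nested floors give ⌊⌊X/q⌋/d⌋ = ⌊c m/q⌋. Taking X to be a multiple
-- of 210 makes X / d = c m exact.
V-floors : ∀ {cs} m → All (_∣ 210) cs →
           V (m * 210) (λ i → floors cs (m * 210 / suc i)) ≡ factorials cs m
V-floors m [] = V-0 (m * 210)
V-floors {c ∷ cs} m (c∣210 ∷ cs∣210) = begin
  V X (λ i → c * (X / suc i) / 210 + floors cs (X / suc i))
    ≡⟨ V-+ X (λ i → c * (X / suc i) / 210) (λ i → floors cs (X / suc i)) ⟩
  V X (λ i → c * (X / suc i) / 210) * V X (λ i → floors cs (X / suc i))
    ≡⟨ cong₂ _*_ (trans (V-cong X (λ i _ → nested i)) (V-! (c * m) X cm≤X)) (V-floors m cs∣210) ⟩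
  (c * m) ! * factorials cs m ∎
  where
  open ≡-Reasoning
  X = m * 210
  d = quotient c∣210
  instance
    c≢0 : NonZero c
    c≢0 = ≢-nonZero λ { refl → contradiction (0∣⇒≡0 c∣210) λ () }
    d≢0 : NonZero d
    d≢0 = quotient≢0 c∣210
    dc≢0 : NonZero (d * c)
    dc≢0 = m*n≢0 d c
  210≡ : 210 ≡ d * c
  210≡ = m∣n⇒n≡quotient*m c∣210
  X≡ : X ≡ c * m * d
  X≡ = trans (cong (m *_) 210≡) (eq m d c)
    where
    eq : ∀ m d c → m * (d * c) ≡ c * m * d
    eq = solve-∀
  cm≤X : c * m ≤ X
  cm≤X = ≤-trans (m≤m*n (c * m) d) (≤-reflexive (sym X≡))
  nested : ∀ i → c * (X / suc i) / 210 ≡ c * m / suc i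
  nested i = begin
    c * (X / suc i) / 210        ≡⟨ /-congʳ 210≡ ⟩
    c * (X / suc i) / (d * c)    ≡⟨ /-congˡ (*-comm c (X / suc i)) ⟩
    X / suc i * c / (d * c)      ≡⟨ m*n/o*n≡m/o (X / suc i) c d ⟩
    X / suc i / d                ≡⟨ m/n/o≡m/[n*o] X (suc i) d {{_}} {{_}} {{m*n≢0 (suc i) d}} ⟩
    _/_ X (suc i * d) {{m*n≢0 (suc i) d}}       ≡⟨ /-congˡ {{m*n≢0 (suc i) d}} X≡ ⟩
    _/_ (c * m * d) (suc i * d) {{m*n≢0 (suc i) d}} ≡⟨ m*n/o*n≡m/o (c * m) d (suc i) {{_}} {{m*n≢0 (suc i) d}} ⟩
    c * m / suc i                ∎

≤/⇒≤/ : ∀ {q k X} → .{{_ : NonZero q}} → .{{_ : NonZero k}} → q ≤ X / k → k ≤ X / q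
≤/⇒≤/ {q} {k} {X} q≤X/k = begin
  k            ≡⟨ m*n/n≡m k q ⟨
  k * q / q    ≤⟨ /-monoˡ-≤ q (begin
    k * q          ≤⟨ *-monoʳ-≤ k q≤X/k ⟩
    k * (X / k)    ≡⟨ *-comm k (X / k) ⟩
    X / k * k      ≤⟨ m/n*n≤m X k ⟩
    X              ∎) ⟩
  X / q        ∎
  where open ≤-Reasoning

-- k ≤ ⌊X/q⌋ and q ≤ ⌊X/k⌋ both say that k q ≤ X.
V-steps : ∀ {ks} X → All (0 <_) ks → V X (λ i → steps ks (X / suc i)) ≡ Ψ X ks
V-steps X [] = V-0 X
V-steps {suc k ∷ ks} X (_ ∷ 0<ks) = begin
  V X (λ i → ι (suc k ≤? X / suc i) + steps ks (X / suc i))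
    ≡⟨ V-+ X (λ i → ι (suc k ≤? X / suc i)) (λ i → steps ks (X / suc i)) ⟩
  V X (λ i → ι (suc k ≤? X / suc i)) * V X (λ i → steps ks (X / suc i))
    ≡⟨ cong₂ _*_ (trans (V-cong X λ i _ → ι-cong (suc k ≤? X / suc i) (suc i ≤? X / suc k) (≤/⇒≤/ {suc k} {suc i} {X}) (≤/⇒≤/ {suc i} {suc k} {X}))
                        (V-L (X / suc k) X (m/n≤m X (suc k))))
                 (V-steps X 0<ks) ⟩
  L (X / suc k) * Ψ X ks ∎
  where open ≡-Reasoning

-- Terms of negative sign are moved across, so that `A`, `B` list cofactors and `K`, `M` thresholds
-- on the two sides. `balanced` is Σ ±1/d = 0 multiplied by 210.
record Certificate (A K B M : List ℕ) : Set where
  field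
    A∣210     : All (_∣ 210) A
    B∣210     : All (_∣ 210) B
    0<K       : All (0 <_) K
    0<M       : All (0 <_) M
    balanced  : sum A ≡ sum B
    dominated : ∀ Y → floors A Y + steps K Y ≤ floors B Y + steps M Y

floors-+ : ∀ cs Y → floors cs (Y + 210) ≡ floors cs Y + sum cs
floors-+ [] Y = refl
floors-+ (c ∷ cs) Y = begin
  c * (Y + 210) / 210 + floors cs (Y + 210)        ≡⟨ cong₂ _+_ shift (floors-+ cs Y) ⟩
  c * Y / 210 + c + (floors cs Y + sum cs)         ≡⟨ eq (c * Y / 210) c (floors cs Y) (sum cs) ⟩
  c * Y / 210 + floors cs Y + (c + sum cs)         ∎
  where
  open ≡-Reasoning
  eq : ∀ a b x y → a + b + (x + y) ≡ a + x + (b + y)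
  eq = solve-∀
  shift : c * (Y + 210) / 210 ≡ c * Y / 210 + c
  shift = begin
    c * (Y + 210) / 210              ≡⟨ /-congˡ (*-distribˡ-+ c Y 210) ⟩
    (c * Y + c * 210) / 210          ≡⟨ +-distrib-/-∣ʳ (c * Y) (n∣m*n c) ⟩
    c * Y / 210 + c * 210 / 210      ≡⟨ cong (c * Y / 210 +_) (m*n/n≡m c 210) ⟩
    c * Y / 210 + c                  ∎

steps-saturated : ∀ {ks} → All (_≤ 210) ks → ∀ {Y Z} → 210 ≤ Y → 210 ≤ Z → steps ks Y ≡ steps ks Z
steps-saturated [] _ _ = refl
steps-saturated {k ∷ _} (k≤ ∷ ks≤) {Y} {Z} 210≤Y 210≤Z = cong₂ _+_
  (trans (ι-yes (k ≤? Y) (≤-trans k≤ 210≤Y)) (sym (ι-yes (k ≤? Z) (≤-trans k≤ 210≤Z))))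
  (steps-saturated ks≤ 210≤Y 210≤Z)

-- Once Y ≥ 210 all steps are saturated, and a shift by 210 adds the same sum to the floors on
-- either side. One initial and one saturated period, Y < 420, therefore decide all Y.
dominated-periodic : ∀ {A K B M} → All (_≤ 210) K → All (_≤ 210) M → sum A ≡ sum B →
  (∀ {Y} → Y < 420 → floors A Y + steps K Y ≤ floors B Y + steps M Y) →
  ∀ Y → floors A Y + steps K Y ≤ floors B Y + steps M Y
dominated-periodic {A} {K} {B} {M} K≤ M≤ ΣA≡ΣB below Y = subst P Y≡ (go (Y / 210) (Y % 210) (m%n<n Y 210))
  where
  open ≤-Reasoning
  P : ℕ → Set
  P Y = floors A Y + steps K Y ≤ floors B Y + steps M Y
  Y≡ : Y % 210 + Y / 210 * 210 ≡ Y
  Y≡ = sym (m≡m%n+[m/n]*n Y 210)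
  eq : ∀ a b c → a + b + c ≡ a + c + b
  eq = solve-∀
  shift : ∀ Y → 210 ≤ Y → P Y → P (Y + 210)
  shift Y 210≤Y PY = begin
    floors A (Y + 210) + steps K (Y + 210)   ≡⟨ cong₂ _+_ (floors-+ A Y) (steps-saturated K≤ (m≤n+m 210 Y) 210≤Y) ⟩
    floors A Y + sum A + steps K Y           ≡⟨ eq (floors A Y) (sum A) (steps K Y) ⟩
    floors A Y + steps K Y + sum A           ≤⟨ +-mono-≤ PY (≤-reflexive ΣA≡ΣB) ⟩
    floors B Y + steps M Y + sum B           ≡⟨ eq (floors B Y) (steps M Y) (sum B) ⟩
    floors B Y + sum B + steps M Y           ≡⟨ cong₂ _+_ (floors-+ B Y) (steps-saturated M≤ (m≤n+m 210 Y) 210≤Y) ⟨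
    floors B (Y + 210) + steps M (Y + 210)   ∎
  go : ∀ j r → r < 210 → P (r + j * 210)
  go 0 r r< = below (+-mono-≤ r< z≤n)
  go 1 r r< = below (+-monoˡ-< 210 r<)
  go (2+ j) r r< = subst P (eq₂ r j) (shift (r + suc j * 210) (≤-trans (m≤m+n 210 (j * 210)) (m≤n+m (suc j * 210) r)) (go (suc j) r r<))
    where
    eq₂ : ∀ r j → r + suc j * 210 + 210 ≡ r + 2+ j * 210
    eq₂ = solve-∀

^-exchange : ∀ x m n → (x ^ m) ^ n ≡ (x ^ n) ^ m
^-exchange x m n = trans (^-*-assoc x m n) (trans (cong (x ^_) (*-comm m n)) (sym (^-*-assoc x n m)))

self-power-split : ∀ c m F → (c * m) ^ (c * m) * F ^ (c * m) ≡ (c ^ c) ^ m * ((m * F) ^ m) ^ c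
self-power-split c m F = begin
  (c * m) ^ (c * m) * F ^ (c * m)      ≡⟨ ^-distribʳ-* (c * m) (c * m) F ⟨
  (c * m * F) ^ (c * m)                ≡⟨ cong (_^ (c * m)) (*-assoc c m F) ⟩
  (c * (m * F)) ^ (c * m)              ≡⟨ ^-distribʳ-* (c * m) c (m * F) ⟩
  c ^ (c * m) * (m * F) ^ (c * m)      ≡⟨ cong₂ _*_ (^-*-assoc c c m) (^-*-assoc (m * F) c m) ⟨
  (c ^ c) ^ m * ((m * F) ^ c) ^ m      ≡⟨ cong ((c ^ c) ^ m *_) (^-exchange (m * F) c m) ⟩
  (c ^ c) ^ m * ((m * F) ^ m) ^ c      ∎
  where open ≡-Reasoning

factorials-lower : ∀ {cs} J m → All (λ c → c * m ≤ J) cs → let open Stirling J in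
  selfPowers cs ^ m * ((m * F) ^ m) ^ sum cs ≤ factorials cs m * (E ^ m) ^ sum cs
factorials-lower J m [] = ≤-reflexive (cong (_* 1) (^-zeroˡ m))
factorials-lower {c ∷ cs} J m (cm≤J ∷ cs≤J) = begin
  (c ^ c * selfPowers cs) ^ m * f ^ (c + sum cs)
    ≡⟨ cong₂ _*_ (^-distribʳ-* m (c ^ c) (selfPowers cs)) (^-distribˡ-+-* f c (sum cs)) ⟩
  (c ^ c) ^ m * selfPowers cs ^ m * (f ^ c * f ^ sum cs)
    ≡⟨ [m*n]*[o*p]≡[m*o]*[n*p] ((c ^ c) ^ m) (selfPowers cs ^ m) (f ^ c) (f ^ sum cs) ⟩
  (c ^ c) ^ m * f ^ c * (selfPowers cs ^ m * f ^ sum cs)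
    ≤⟨ *-mono-≤ single (factorials-lower J m cs≤J) ⟩
  (c * m) ! * e ^ c * (factorials cs m * e ^ sum cs)
    ≡⟨ [m*n]*[o*p]≡[m*o]*[n*p] ((c * m) !) (e ^ c) (factorials cs m) (e ^ sum cs) ⟩
  (c * m) ! * factorials cs m * (e ^ c * e ^ sum cs)
    ≡⟨ cong ((c * m) ! * factorials cs m *_) (^-distribˡ-+-* e c (sum cs)) ⟨
  (c * m) ! * factorials cs m * e ^ (c + sum cs) ∎
  where
  open ≤-Reasoning
  open Stirling J
  e = E ^ m
  f = (m * F) ^ m
  single : (c ^ c) ^ m * f ^ c ≤ (c * m) ! * e ^ c
  single = begin
    (c ^ c) ^ m * f ^ c                     ≡⟨ self-power-split c m F ⟨
    (c * m) ^ (c * m) * F ^ (c * m)         ≤⟨ !-lower (c * m) cm≤J ⟩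
    (c * m) ! * E ^ (c * m)                 ≡⟨ cong ((c * m) ! *_) (trans (sym (^-*-assoc E c m)) (^-exchange E c m)) ⟩
    (c * m) ! * e ^ c                       ∎

-- Only this side of Stirling's approximation loses a polynomial factor, which is why the later
-- error terms involve `length B` and not `length A`.
factorials-upper : ∀ {cs} J m → .{{NonZero m}} → All NonZero cs → All (λ c → c * m ≤ J) cs → let open Stirling J in
  factorials cs m * (E ^ m) ^ sum cs ≤ (4 * J) ^ length cs * (selfPowers cs ^ m * ((m * F) ^ m) ^ sum cs)
factorials-upper J m [] [] = ≤-reflexive (sym (trans (*-identityˡ _) (cong (_* 1) (^-zeroˡ m))))
factorials-upper {c ∷ cs} J m (c≢0 ∷ cs≢0) (cm≤J ∷ cs≤J) = begin
  (c * m) ! * factorials cs m * e ^ (c + sum cs)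
    ≡⟨ cong ((c * m) ! * factorials cs m *_) (^-distribˡ-+-* e c (sum cs)) ⟩
  (c * m) ! * factorials cs m * (e ^ c * e ^ sum cs)
    ≡⟨ [m*n]*[o*p]≡[m*o]*[n*p] ((c * m) !) (factorials cs m) (e ^ c) (e ^ sum cs) ⟩
  (c * m) ! * e ^ c * (factorials cs m * e ^ sum cs)
    ≤⟨ *-mono-≤ single (factorials-upper J m cs≢0 cs≤J) ⟩
  4 * J * ((c ^ c) ^ m * f ^ c) * ((4 * J) ^ length cs * (selfPowers cs ^ m * f ^ sum cs))
    ≡⟨ eq (4 * J) ((c ^ c) ^ m) (f ^ c) ((4 * J) ^ length cs) (selfPowers cs ^ m) (f ^ sum cs) ⟩
  4 * J * (4 * J) ^ length cs * ((c ^ c) ^ m * selfPowers cs ^ m * (f ^ c * f ^ sum cs))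
    ≡⟨ cong (4 * J * (4 * J) ^ length cs *_) (cong₂ _*_ (^-distribʳ-* m (c ^ c) (selfPowers cs)) (^-distribˡ-+-* f c (sum cs))) ⟨
  4 * J * (4 * J) ^ length cs * ((c ^ c * selfPowers cs) ^ m * f ^ (c + sum cs)) ∎
  where
  open ≤-Reasoning
  open Stirling J
  e = E ^ m
  f = (m * F) ^ m
  eq : ∀ a b c d e f → a * (b * c) * (d * (e * f)) ≡ a * d * (b * e * (c * f))
  eq = solve-∀
  single : (c * m) ! * e ^ c ≤ 4 * J * ((c ^ c) ^ m * f ^ c)
  single = begin
    (c * m) ! * e ^ c                           ≡⟨ cong ((c * m) ! *_) (trans (sym (^-*-assoc E c m)) (^-exchange E c m)) ⟨
    (c * m) ! * E ^ (c * m)                     ≤⟨ !-upper (c * m) {{m*n≢0 c m {{c≢0}}}} cm≤J ⟩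
    4 * (c * m) * ((c * m) ^ (c * m) * F ^ (c * m)) ≤⟨ *-mono-≤ (*-monoʳ-≤ 4 cm≤J) (≤-reflexive (self-power-split c m F)) ⟩
    4 * J * ((c ^ c) ^ m * f ^ c)               ∎

chebyshev : ∀ {A K B M} → Certificate A K B M → ∀ m → .{{NonZero m}} →
  Ψ (m * 210) K * selfPowers A ^ m ≤ (4 * (m * 210)) ^ length B * selfPowers B ^ m * Ψ (m * 210) M
chebyshev {A} {K} {B} {M} cert m = *-cancelʳ-≤ _ _ (f ^ sum A * e ^ sum A) {{m*n≢0 (f ^ sum A) (e ^ sum A) {{m^n≢0 f (sum A)}} {{m^n≢0 e (sum A)}}}} (begin
  Ψ X K * PA * (f ^ sum A * e ^ sum A)
    ≡⟨ eq₁ (Ψ X K) PA (f ^ sum A) (e ^ sum A) ⟩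
  PA * f ^ sum A * (Ψ X K * e ^ sum A)
    ≤⟨ *-monoˡ-≤ (Ψ X K * e ^ sum A) (factorials-lower X m (c*m≤X A∣210)) ⟩
  factorials A m * e ^ sum A * (Ψ X K * e ^ sum A)
    ≡⟨ eq₂ (factorials A m) (e ^ sum A) (Ψ X K) ⟩
  factorials A m * Ψ X K * (e ^ sum A * e ^ sum A)
    ≤⟨ *-monoˡ-≤ (e ^ sum A * e ^ sum A) main ⟩
  factorials B m * Ψ X M * (e ^ sum A * e ^ sum A)
    ≡⟨ cong (λ s → factorials B m * Ψ X M * (e ^ s * e ^ sum A)) balanced ⟩
  factorials B m * Ψ X M * (e ^ sum B * e ^ sum A)
    ≡⟨ [m*n]*[o*p]≡[m*o]*[n*p] (factorials B m) (Ψ X M) (e ^ sum B) (e ^ sum A) ⟩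
  factorials B m * e ^ sum B * (Ψ X M * e ^ sum A)
    ≤⟨ *-monoˡ-≤ (Ψ X M * e ^ sum A) (factorials-upper X m (c≢0 B∣210) (c*m≤X B∣210)) ⟩
  (4 * X) ^ length B * (PB * f ^ sum B) * (Ψ X M * e ^ sum A)
    ≡⟨ cong (λ s → (4 * X) ^ length B * (PB * f ^ s) * (Ψ X M * e ^ sum A)) balanced ⟨
  (4 * X) ^ length B * (PB * f ^ sum A) * (Ψ X M * e ^ sum A)
    ≡⟨ eq₃ ((4 * X) ^ length B) PB (f ^ sum A) (Ψ X M) (e ^ sum A) ⟩
  (4 * X) ^ length B * PB * Ψ X M * (f ^ sum A * e ^ sum A) ∎)
  where
  open ≤-Reasoning
  open Certificate cert
  X  = m * 210
  open Stirling X
  PA = selfPowers A ^ m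
  PB = selfPowers B ^ m
  e = E ^ m
  f = (m * F) ^ m
  instance
    X≢0 : NonZero X
    X≢0 = m*n≢0 m 210
    F≢0 : NonZero F
    F≢0 = m^n≢0 X X
    E≢0 : NonZero E
    E≢0 = m^n≢0 (suc X) X
    e≢0 : NonZero e
    e≢0 = m^n≢0 E m
    f≢0 : NonZero f
    f≢0 = m^n≢0 (m * F) m {{m*n≢0 m F}}
  c*m≤X : ∀ {cs} → All (_∣ 210) cs → All (λ c → c * m ≤ X) cs
  c*m≤X = All.map (λ {c} c∣210 → ≤-trans (*-monoˡ-≤ m (∣⇒≤ c∣210)) (≤-reflexive (*-comm 210 m)))
  c≢0 : ∀ {cs} → All (_∣ 210) cs → All NonZero cs
  c≢0 = All.map (λ { {zero} 0∣210 → contradiction (0∣⇒≡0 0∣210) λ () ; {suc _} _ → _ })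
  main : factorials A m * Ψ X K ≤ factorials B m * Ψ X M
  main = begin
    factorials A m * Ψ X K
      ≡⟨ cong₂ _*_ (V-floors m A∣210) (V-steps X 0<K) ⟨
    V X (λ i → floors A (X / suc i)) * V X (λ i → steps K (X / suc i))
      ≡⟨ V-+ X (λ i → floors A (X / suc i)) (λ i → steps K (X / suc i)) ⟨
    V X (λ i → floors A (X / suc i) + steps K (X / suc i))
      ≤⟨ V-mono-≤ X (λ i _ → dominated (X / suc i)) ⟩
    V X (λ i → floors B (X / suc i) + steps M (X / suc i))
      ≡⟨ V-+ X (λ i → floors B (X / suc i)) (λ i → steps M (X / suc i)) ⟩
    V X (λ i → floors B (X / suc i)) * V X (λ i → steps M (X / suc i))
      ≡⟨ cong₂ _*_ (V-floors m B∣210) (V-steps X 0<M) ⟩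
    factorials B m * Ψ X M ∎
  eq₁ : ∀ a b c d → a * b * (c * d) ≡ b * c * (a * d)
  eq₁ = solve-∀
  eq₂ : ∀ a b c → a * b * (c * b) ≡ a * c * (b * b)
  eq₂ = solve-∀
  eq₃ : ∀ a b c d e → a * (b * c) * (d * e) ≡ a * b * d * (c * e)
  eq₃ = solve-∀

-- Bootstrapping the bounds on ψ

-- Linear bounds on 64 log₂ L(210 m); the factor 64 makes integral slopes precise enough.
record Upper (u C : ℕ) : Set where
  constructor mkUpper
  field at : ∀ m → L (m * 210) ^ 64 ≤ 2 ^ (m * u + C)

record Lower (l C : ℕ) : Set where
  constructor mkLower
  field at : ∀ m → 2 ^ (m * l) ≤ L (m * 210) ^ 64 * 2 ^ C

-- u / k is rounded up here and l / k down in `quotients`, so that slopes stay integral and the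
-- bounds safe.
ceilings : ℕ → List ℕ → ℕ
ceilings u ks = sum (map (λ k → suc (u ÷ k)) ks)

quotients : ℕ → List ℕ → ℕ
quotients l ks = sum (map (λ k → l ÷ k) ks)

m<suc[m/n]*n : ∀ m n → .{{_ : NonZero n}} → m < suc (m / n) * n
m<suc[m/n]*n m n = subst (_< suc (m / n) * n) (sym (m≡m%n+[m/n]*n m n)) (+-monoˡ-< (m / n * n) (m%n<n m n))

-- The argument is enlarged to the next multiple of 210 covered by `upper`; this costs one extra `u`
-- in the constant.
L/-upper : ∀ {u C} → Upper u C → ∀ m k → .{{_ : NonZero k}} →
           L (m * 210 / k) ^ 64 ≤ 2 ^ (m * suc (u / k) + (u + C))
L/-upper {u} {C} upper m k = begin
  L (m * 210 / k) ^ 64                ≤⟨ ^-monoˡ-≤ 64 (L-mono-≤ (<⇒≤ (m<n*o⇒m/o<n {m * 210} {suc (m / k) * 210} {k} (begin-strict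
    m * 210                             <⟨ *-monoˡ-< 210 (m<suc[m/n]*n m k) ⟩
    suc (m / k) * k * 210               ≡⟨ eq₁ (suc (m / k)) k ⟩
    suc (m / k) * 210 * k               ∎)))) ⟩
  L (suc (m / k) * 210) ^ 64          ≤⟨ Upper.at upper (suc (m / k)) ⟩
  2 ^ (suc (m / k) * u + C)           ≤⟨ ^-monoʳ-≤ 2 exponents ⟩
  2 ^ (m * suc (u / k) + (u + C))     ∎
  where
  open ≤-Reasoning
  eq₁ : ∀ a k → a * k * 210 ≡ a * 210 * k
  eq₁ = solve-∀
  eq₂ : ∀ a b k → a * (b * k) ≡ a * k * b
  eq₂ = solve-∀
  exponents : suc (m / k) * u + C ≤ m * suc (u / k) + (u + C)
  exponents = begin
    u + m / k * u + C                         ≤⟨ +-monoˡ-≤ C (+-monoʳ-≤ u (begin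
      m / k * u                                 ≤⟨ *-monoʳ-≤ (m / k) (<⇒≤ (m<suc[m/n]*n u k)) ⟩
      m / k * (suc (u / k) * k)                 ≡⟨ eq₂ (m / k) (suc (u / k)) k ⟩
      m / k * k * suc (u / k)                   ≤⟨ *-monoˡ-≤ (suc (u / k)) (m/n*n≤m m k) ⟩
      m * suc (u / k)                           ∎)) ⟩
    u + m * suc (u / k) + C                   ≡⟨ cong (_+ C) (+-comm u (m * suc (u / k))) ⟩
    m * suc (u / k) + u + C                   ≡⟨ +-assoc (m * suc (u / k)) u C ⟩
    m * suc (u / k) + (u + C)                 ∎

L/-lower : ∀ {l C} → Lower l C → ∀ m k → .{{_ : NonZero k}} →
           2 ^ (m * (l / k)) ≤ L (m * 210 / k) ^ 64 * 2 ^ (l + C)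
L/-lower {l} {C} lower m k = begin
  2 ^ (m * (l / k))                             ≤⟨ ^-monoʳ-≤ 2 exponents ⟩
  2 ^ (m / k * l + l)                           ≡⟨ ^-distribˡ-+-* 2 (m / k * l) l ⟩
  2 ^ (m / k * l) * 2 ^ l                       ≤⟨ *-monoˡ-≤ (2 ^ l) (Lower.at lower (m / k)) ⟩
  L (m / k * 210) ^ 64 * 2 ^ C * 2 ^ l          ≤⟨ *-monoˡ-≤ (2 ^ l) (*-monoˡ-≤ (2 ^ C) (^-monoˡ-≤ 64 (L-mono-≤ (begin
    m / k * 210                                   ≡⟨ m*n/n≡m (m / k * 210) k ⟨
    m / k * 210 * k / k                           ≤⟨ /-monoˡ-≤ k (begin
      m / k * 210 * k                               ≡⟨ eq₁ (m / k) k ⟩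
      m / k * k * 210                               ≤⟨ *-monoˡ-≤ 210 (m/n*n≤m m k) ⟩
      m * 210                                       ∎) ⟩
    m * 210 / k                                   ∎)))) ⟩
  L (m * 210 / k) ^ 64 * 2 ^ C * 2 ^ l          ≡⟨ *-assoc (L (m * 210 / k) ^ 64) (2 ^ C) (2 ^ l) ⟩
  L (m * 210 / k) ^ 64 * (2 ^ C * 2 ^ l)        ≡⟨ cong (L (m * 210 / k) ^ 64 *_) (trans (cong (2 ^_) (+-comm l C)) (^-distribˡ-+-* 2 C l)) ⟨
  L (m * 210 / k) ^ 64 * 2 ^ (l + C)            ∎
  where
  open ≤-Reasoning
  eq₁ : ∀ a k → a * 210 * k ≡ a * k * 210
  eq₁ = solve-∀
  eq₂ : ∀ a b k → suc a * k * b ≡ a * (b * k) + b * k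
  eq₂ = solve-∀
  exponents : m * (l / k) ≤ m / k * l + l
  exponents = begin
    m * (l / k)                        ≤⟨ *-monoˡ-≤ (l / k) (<⇒≤ (m<suc[m/n]*n m k)) ⟩
    suc (m / k) * k * (l / k)          ≡⟨ eq₂ (m / k) (l / k) k ⟩
    m / k * (l / k * k) + l / k * k    ≤⟨ +-mono-≤ (*-monoʳ-≤ (m / k) (m/n*n≤m l k)) (m/n*n≤m l k) ⟩
    m / k * l + l                      ∎

Ψ-upper : ∀ {u C} → Upper u C → ∀ m ks →
          Ψ (m * 210) ks ^ 64 ≤ 2 ^ (m * ceilings u ks + length ks * (u + C))
Ψ-upper {u} {C} upper m [] = ≤-reflexive (trans (^-zeroˡ 64) (cong (2 ^_) (sym (trans (+-identityʳ (m * 0)) (*-zeroʳ m)))))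
Ψ-upper {u} {C} upper m (k ∷ ks) = begin
  (L (m * 210 ÷ k) * Ψ (m * 210) ks) ^ 64
    ≡⟨ ^-distribʳ-* 64 (L (m * 210 ÷ k)) (Ψ (m * 210) ks) ⟩
  L (m * 210 ÷ k) ^ 64 * Ψ (m * 210) ks ^ 64
    ≤⟨ *-mono-≤ (L/-upper upper m (suc (pred k))) (Ψ-upper {u} {C} upper m ks) ⟩
  2 ^ (m * suc (u ÷ k) + (u + C)) * 2 ^ (m * ceilings u ks + length ks * (u + C))
    ≡⟨ ^-distribˡ-+-* 2 (m * suc (u ÷ k) + (u + C)) _ ⟨
  2 ^ (m * suc (u ÷ k) + (u + C) + (m * ceilings u ks + length ks * (u + C)))
    ≡⟨ cong (2 ^_) (eq m (suc (u ÷ k)) (u + C) (ceilings u ks) (length ks)) ⟩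
  2 ^ (m * (suc (u ÷ k) + ceilings u ks) + suc (length ks) * (u + C)) ∎
  where
  open ≤-Reasoning
  eq : ∀ m a b c n → m * a + b + (m * c + n * b) ≡ m * (a + c) + suc n * b
  eq = solve-∀

Ψ-lower : ∀ {l C} → Lower l C → ∀ m ks →
          2 ^ (m * quotients l ks) ≤ Ψ (m * 210) ks ^ 64 * 2 ^ (length ks * (l + C))
Ψ-lower {l} {C} lower m [] = ≤-reflexive (trans (cong (2 ^_) (*-zeroʳ m)) (sym (trans (*-identityʳ (1 ^ 64)) (^-zeroˡ 64))))
Ψ-lower {l} {C} lower m (k ∷ ks) = begin
  2 ^ (m * (l ÷ k + quotients l ks))
    ≡⟨ trans (cong (2 ^_) (*-distribˡ-+ m (l ÷ k) (quotients l ks))) (^-distribˡ-+-* 2 (m * (l ÷ k)) (m * quotients l ks)) ⟩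
  2 ^ (m * (l ÷ k)) * 2 ^ (m * quotients l ks)
    ≤⟨ *-mono-≤ (L/-lower lower m (suc (pred k))) (Ψ-lower {l} {C} lower m ks) ⟩
  a ^ 64 * 2 ^ (l + C) * (b ^ 64 * 2 ^ (length ks * (l + C)))
    ≡⟨ [m*n]*[o*p]≡[m*o]*[n*p] (a ^ 64) (2 ^ (l + C)) (b ^ 64) _ ⟩
  a ^ 64 * b ^ 64 * (2 ^ (l + C) * 2 ^ (length ks * (l + C)))
    ≡⟨ cong₂ _*_ (^-distribʳ-* 64 a b) (^-distribˡ-+-* 2 (l + C) (length ks * (l + C))) ⟨
  (a * b) ^ 64 * 2 ^ (suc (length ks) * (l + C)) ∎
  where
  open ≤-Reasoning
  a = L (m * 210 ÷ k)
  b = Ψ (m * 210) ks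

n<2^n : ∀ n → n < 2 ^ n
n<2^n zero    = s≤s z≤n
n<2^n (suc n) = begin-strict
  suc n            ≤⟨ n<2^n n ⟩
  2 ^ n            <⟨ m<m+n (2 ^ n) (m^n>0 2 n) ⟩
  2 ^ n + 2 ^ n    ≡⟨ cong (2 ^ n +_) (+-identityʳ (2 ^ n)) ⟨
  2 ^ suc n        ∎
  where open ≤-Reasoning

m≤2^[m/d]*d : ∀ m d → .{{_ : NonZero d}} → m ≤ 2 ^ (m / d) * d
m≤2^[m/d]*d m d = ≤-trans (<⇒≤ (m<suc[m/n]*n m d)) (*-monoˡ-≤ d (n<2^n (m / d)))

power-of-bound : ∀ {X} m b s k d → .{{_ : NonZero d}} → X ≤ 2 ^ (m / d + k) → b * s ≤ d →
                 (X ^ b) ^ s ≤ 2 ^ (m + b * s * k)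
power-of-bound {X} m b s k d X≤ bs≤d = begin
  (X ^ b) ^ s                          ≡⟨ ^-*-assoc X b s ⟩
  X ^ (b * s)                          ≤⟨ ^-monoˡ-≤ (b * s) X≤ ⟩
  (2 ^ (m / d + k)) ^ (b * s)          ≡⟨ ^-*-assoc 2 (m / d + k) (b * s) ⟩
  2 ^ ((m / d + k) * (b * s))          ≤⟨ ^-monoʳ-≤ 2 (begin
    (m / d + k) * (b * s)                ≡⟨ eq k (m / d) (b * s) ⟩
    m / d * (b * s) + b * s * k          ≤⟨ +-monoˡ-≤ (b * s * k) (*-monoʳ-≤ (m / d) bs≤d) ⟩
    m / d * d + b * s * k                ≤⟨ +-monoˡ-≤ (b * s * k) (m/n*n≤m m d) ⟩
    m + b * s * k                        ∎) ⟩
  2 ^ (m + b * s * k)                  ∎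
  where
  open ≤-Reasoning
  eq : ∀ k q n → (q + k) * n ≡ q * n + n * k
  eq = solve-∀

m*c≤2^ : ∀ m c a b d → .{{_ : NonZero d}} → d ≡ 2 ^ a → c ≤ 2 ^ b → m * c ≤ 2 ^ (m / d + (a + b))
m*c≤2^ m c a b d refl c≤2ᵇ = begin
  m * c                                ≤⟨ *-mono-≤ (m≤2^[m/d]*d m d) c≤2ᵇ ⟩
  2 ^ (m / d) * 2 ^ a * 2 ^ b          ≡⟨ *-assoc (2 ^ (m / d)) (2 ^ a) (2 ^ b) ⟩
  2 ^ (m / d) * (2 ^ a * 2 ^ b)        ≡⟨ cong (2 ^ (m / d) *_) (^-distribˡ-+-* 2 a b) ⟨
  2 ^ (m / d) * 2 ^ (a + b)            ≡⟨ ^-distribˡ-+-* 2 (m / d) (a + b) ⟨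
  2 ^ (m / d + (a + b))                  ∎
  where open ≤-Reasoning

4*[m*c]≡ : ∀ m c → 4 * (m * c) ≡ m * (c * 4)
4*[m*c]≡ m c = trans (*-comm 4 (m * c)) (*-assoc m c 4)

-- From m ≤ 2^⌊m/4096⌋ · 2¹² and 840 ≤ 2¹⁰ comes the 22. Raising to a power of at most 4096 turns
-- ⌊m/4096⌋ into at most m, so the polynomial factor costs one unit of slope: the `+ 1` in the slope
-- conditions below.
stirling-error : ∀ m b → b * 64 ≤ 4096 → ((4 * (m * 210)) ^ b) ^ 64 ≤ 2 ^ (m + b * 64 * 22)
stirling-error m b = power-of-bound m b 64 22 4096
  (≤-trans (≤-reflexive (4*[m*c]≡ m 210)) (m*c≤2^ m 840 12 10 4096 refl (≤ᵇ⇒≤ 840 1024 _)))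

selfPowers≢0 : ∀ {cs} → All (_∣ 210) cs → NonZero (selfPowers cs)
selfPowers≢0 [] = _
selfPowers≢0 {zero ∷ cs}      (0∣210 ∷ _) = contradiction (0∣⇒≡0 0∣210) λ ()
selfPowers≢0 {c@(suc _) ∷ cs} (_ ∷ cs∣)  = m*n≢0 (c ^ c) (selfPowers cs) {{m^n≢0 c c}} {{selfPowers≢0 cs∣}}

-- `x` and `y` let the caller write the threshold 1 as `L X` instead of `L (X ÷ 1)`.
chebyshev-bits : ∀ {A K B M} → Certificate A K B M → length B * 64 ≤ 4096 → ∀ m → .{{NonZero m}} → ∀ {x y} → Ψ (m * 210) K ≡ x → Ψ (m * 210) M ≡ y →
  x ^ 64 * (selfPowers A ^ 64) ^ m ≤ 2 ^ (m + length B * 64 * 22) * (selfPowers B ^ 64) ^ m * y ^ 64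
chebyshev-bits {A} {K} {B} {M} cert b≤ m refl refl = begin
  Ψ X K ^ 64 * (selfPowers A ^ 64) ^ m
    ≡⟨ cong (Ψ X K ^ 64 *_) (^-exchange (selfPowers A) 64 m) ⟩
  Ψ X K ^ 64 * (selfPowers A ^ m) ^ 64
    ≡⟨ ^-distribʳ-* 64 (Ψ X K) (selfPowers A ^ m) ⟨
  (Ψ X K * selfPowers A ^ m) ^ 64
    ≤⟨ ^-monoˡ-≤ 64 (chebyshev cert m) ⟩
  (err * selfPowers B ^ m * Ψ X M) ^ 64
    ≡⟨ trans (^-distribʳ-* 64 (err * selfPowers B ^ m) (Ψ X M)) (cong (_* Ψ X M ^ 64) (^-distribʳ-* 64 err (selfPowers B ^ m))) ⟩
  err ^ 64 * (selfPowers B ^ m) ^ 64 * Ψ X M ^ 64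
    ≡⟨ cong (λ z → err ^ 64 * z * Ψ X M ^ 64) (^-exchange (selfPowers B) m 64) ⟩
  err ^ 64 * (selfPowers B ^ 64) ^ m * Ψ X M ^ 64
    ≤⟨ *-monoˡ-≤ (Ψ X M ^ 64) (*-monoˡ-≤ ((selfPowers B ^ 64) ^ m) (stirling-error m (length B) b≤)) ⟩
  2 ^ (m + length B * 64 * 22) * (selfPowers B ^ 64) ^ m * Ψ X M ^ 64 ∎
  where
  open ≤-Reasoning
  X = m * 210
  err = (4 * X) ^ length B

L÷1 : ∀ n → L (n ÷ 1) ≡ L n
L÷1 n = cong L (n/1≡n n)

L0^64≡1 : L 0 ^ 64 ≡ 1
L0^64≡1 = trans (cong (_^ 64) L-0) (^-zeroˡ 64)

upper-0 : ∀ e → L 0 ^ 64 ≤ 2 ^ e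
upper-0 e = ≤-trans (≤-reflexive L0^64≡1) (m^n>0 2 e)

lower-0 : ∀ e → 1 ≤ L 0 ^ 64 * 2 ^ e
lower-0 e = ≤-trans (m^n>0 2 e) (≤-reflexive (sym (trans (cong (_* 2 ^ e) L0^64≡1) (*-identityˡ (2 ^ e)))))

-- The threshold 1 on the left isolates `L X`. Then `g` bounds the Stirling main term, `upper`
-- bounds the ψ(X/k) with k in `M` from above, and `lower` those with k in `K` from below.
upper-step⁺ : ∀ {A K B M u C l D} → Certificate A (1 ∷ K) B M → Upper u C → Lower l D →
             ∀ g u′ → selfPowers B ^ 64 ≤ 2 ^ g * selfPowers A ^ 64 → length B * 64 ≤ 4096 →
             g + ceilings u M + 1 ≤ u′ + quotients l K →
             ∀ m → .{{_ : NonZero m}} → L (m * 210) ^ 64 ≤ 2 ^ (m * u′ + (length K * (l + D) + length M * (u + C) + length B * 64 * 22))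
upper-step⁺ {A} {K} {B} {M} {u} {C} {l} {D} cert upper lower g u′ B≤A b≤ slopes m =
  *-cancelʳ-≤ _ _ (P * x) {{m*n≢0 P x {{m^n≢0 (selfPowers A ^ 64) m {{m^n≢0 (selfPowers A) 64 {{selfPowers≢0 A∣210}}}}}} {{m^n≢0 2 (m * quotients l K)}}}} (begin
  a * (P * x)
    ≤⟨ *-monoʳ-≤ a (*-monoʳ-≤ P (Ψ-lower lower m K)) ⟩
  a * (P * (Ψ X K ^ 64 * 2 ^ cK))
    ≡⟨ eq₁ a P (Ψ X K ^ 64) (2 ^ cK) ⟩
  a * Ψ X K ^ 64 * P * 2 ^ cK
    ≡⟨ cong (λ z → z * P * 2 ^ cK) (^-distribʳ-* 64 (L X) (Ψ X K)) ⟨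
  (L X * Ψ X K) ^ 64 * P * 2 ^ cK
    ≤⟨ *-monoˡ-≤ (2 ^ cK) (chebyshev-bits cert b≤ m (cong (_* Ψ X K) (L÷1 X)) refl) ⟩
  2 ^ (m + cB) * (selfPowers B ^ 64) ^ m * Ψ X M ^ 64 * 2 ^ cK
    ≤⟨ *-monoˡ-≤ (2 ^ cK) (*-mono-≤ (*-monoʳ-≤ (2 ^ (m + cB)) (^-monoˡ-≤ m B≤A)) (Ψ-upper upper m M)) ⟩
  2 ^ (m + cB) * (2 ^ g * selfPowers A ^ 64) ^ m * 2 ^ (m * ceilings u M + cM) * 2 ^ cK
    ≡⟨ cong (λ z → 2 ^ (m + cB) * z * 2 ^ (m * ceilings u M + cM) * 2 ^ cK)
         (trans (^-distribʳ-* m (2 ^ g) (selfPowers A ^ 64)) (cong (_* P) (trans (^-*-assoc 2 g m) (cong (2 ^_) (*-comm g m))))) ⟩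
  2 ^ (m + cB) * (2 ^ (m * g) * P) * 2 ^ (m * ceilings u M + cM) * 2 ^ cK
    ≡⟨ eq₂ (2 ^ (m + cB)) (2 ^ (m * g)) P (2 ^ (m * ceilings u M + cM)) (2 ^ cK) ⟩
  2 ^ (m + cB) * 2 ^ (m * g) * (2 ^ (m * ceilings u M + cM) * 2 ^ cK) * P
    ≡⟨ cong (_* P) (trans (^-distribˡ-+-* 2 (m + cB + m * g) (m * ceilings u M + cM + cK))
                          (cong₂ _*_ (^-distribˡ-+-* 2 (m + cB) (m * g)) (^-distribˡ-+-* 2 (m * ceilings u M + cM) cK))) ⟨
  2 ^ (m + cB + m * g + (m * ceilings u M + cM + cK)) * P
    ≤⟨ *-monoˡ-≤ P (^-monoʳ-≤ 2 exponents) ⟩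
  2 ^ (m * u′ + (cK + cM + cB) + m * quotients l K) * P
    ≡⟨ cong (_* P) (^-distribˡ-+-* 2 (m * u′ + (cK + cM + cB)) (m * quotients l K)) ⟩
  2 ^ (m * u′ + (cK + cM + cB)) * x * P
    ≡⟨ eq₃ (2 ^ (m * u′ + (cK + cM + cB))) x P ⟩
  2 ^ (m * u′ + (cK + cM + cB)) * (P * x) ∎)
  where
  open ≤-Reasoning
  open Certificate cert
  X = m * 210
  a = L X ^ 64
  P = (selfPowers A ^ 64) ^ m
  x = 2 ^ (m * quotients l K)
  cK = length K * (l + D)
  cM = length M * (u + C)
  cB = length B * 64 * 22
  eq₁ : ∀ a p y z → a * (p * (y * z)) ≡ a * y * p * z
  eq₁ = solve-∀
  eq₂ : ∀ a b p c d → a * (b * p) * c * d ≡ a * b * (c * d) * p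
  eq₂ = solve-∀
  eq₃ : ∀ a b p → a * b * p ≡ a * (p * b)
  eq₃ = solve-∀
  exponents : m + cB + m * g + (m * ceilings u M + cM + cK) ≤ m * u′ + (cK + cM + cB) + m * quotients l K
  exponents = begin
    m + cB + m * g + (m * ceilings u M + cM + cK)     ≡⟨ eq₄ m g (ceilings u M) cB cM cK ⟩
    m * (g + ceilings u M + 1) + (cK + cM + cB)       ≤⟨ +-monoˡ-≤ (cK + cM + cB) (*-monoʳ-≤ m slopes) ⟩
    m * (u′ + quotients l K) + (cK + cM + cB)         ≡⟨ eq₅ m u′ (quotients l K) (cK + cM + cB) ⟩
    m * u′ + (cK + cM + cB) + m * quotients l K       ∎
    where
    eq₄ : ∀ m g c x y z → m + x + m * g + (m * c + y + z) ≡ m * (g + c + 1) + (z + y + x)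
    eq₄ = solve-∀
    eq₅ : ∀ m u q z → m * (u + q) + z ≡ m * u + z + m * q
    eq₅ = solve-∀

upper-step : ∀ {A K B M u C l D} → Certificate A (1 ∷ K) B M → Upper u C → Lower l D →
             ∀ g u′ → selfPowers B ^ 64 ≤ 2 ^ g * selfPowers A ^ 64 → length B * 64 ≤ 4096 →
             g + ceilings u M + 1 ≤ u′ + quotients l K →
             Upper u′ (length K * (l + D) + length M * (u + C) + length B * 64 * 22)
upper-step {K = K} {B} {M} {u} {C} {l} {D} cert upper lower g u′ B≤A b≤ slopes = mkUpper λ where
  zero      → upper-0 (length K * (l + D) + length M * (u + C) + length B * 64 * 22)
  m@(suc _) → upper-step⁺ cert upper lower g u′ B≤A b≤ slopes m

-- Dual to `upper-step⁺`: the threshold 1 is now on the right, and `g` bounds the main term from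
-- below.
lower-step⁺ : ∀ {A K B M u C l D} → Certificate A K B (1 ∷ M) → Upper u C → Lower l D →
             ∀ g l′ → 2 ^ g * selfPowers B ^ 64 ≤ selfPowers A ^ 64 → length B * 64 ≤ 4096 →
             l′ + ceilings u M + 1 ≤ g + quotients l K →
             ∀ m → .{{_ : NonZero m}} → 2 ^ (m * l′) ≤ L (m * 210) ^ 64 * 2 ^ (length K * (l + D) + length M * (u + C) + length B * 64 * 22)
lower-step⁺ {A} {K} {B} {M} {u} {C} {l} {D} cert upper lower g l′ B≤A b≤ slopes m =
  *-cancelʳ-≤ _ _ (P * y) {{m*n≢0 P y {{m^n≢0 (selfPowers B ^ 64) m {{m^n≢0 (selfPowers B) 64 {{selfPowers≢0 B∣210}}}}}} {{m^n≢0 2 (m * suc (ceilings u M))}}}} (begin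
  2 ^ (m * l′) * (P * y)
    ≡⟨ eq₁ (2 ^ (m * l′)) P y ⟩
  2 ^ (m * l′) * y * P
    ≡⟨ cong (_* P) (^-distribˡ-+-* 2 (m * l′) (m * suc (ceilings u M))) ⟨
  2 ^ (m * l′ + m * suc (ceilings u M)) * P
    ≤⟨ *-monoˡ-≤ P (^-monoʳ-≤ 2 exponents) ⟩
  2 ^ (m * g + m * quotients l K) * P
    ≡⟨ cong (_* P) (^-distribˡ-+-* 2 (m * g) (m * quotients l K)) ⟩
  2 ^ (m * g) * x * P
    ≡⟨ eq₂ (2 ^ (m * g)) x P ⟩
  2 ^ (m * g) * P * x
    ≡⟨ cong (_* x) (trans (^-distribʳ-* m (2 ^ g) (selfPowers B ^ 64)) (cong (_* P) (trans (^-*-assoc 2 g m) (cong (2 ^_) (*-comm g m))))) ⟨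
  (2 ^ g * selfPowers B ^ 64) ^ m * x
    ≤⟨ *-mono-≤ (^-monoˡ-≤ m B≤A) (Ψ-lower lower m K) ⟩
  (selfPowers A ^ 64) ^ m * (Ψ X K ^ 64 * 2 ^ cK)
    ≡⟨ eq₃ ((selfPowers A ^ 64) ^ m) (Ψ X K ^ 64) (2 ^ cK) ⟩
  Ψ X K ^ 64 * (selfPowers A ^ 64) ^ m * 2 ^ cK
    ≤⟨ *-monoˡ-≤ (2 ^ cK) (chebyshev-bits cert b≤ m refl (cong (_* Ψ X M) (L÷1 X))) ⟩
  2 ^ (m + cB) * P * (L X * Ψ X M) ^ 64 * 2 ^ cK
    ≡⟨ cong (λ z → 2 ^ (m + cB) * P * z * 2 ^ cK) (^-distribʳ-* 64 (L X) (Ψ X M)) ⟩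
  2 ^ (m + cB) * P * (a * Ψ X M ^ 64) * 2 ^ cK
    ≤⟨ *-monoˡ-≤ (2 ^ cK) (*-monoʳ-≤ (2 ^ (m + cB) * P) (*-monoʳ-≤ a (Ψ-upper upper m M))) ⟩
  2 ^ (m + cB) * P * (a * 2 ^ (m * ceilings u M + cM)) * 2 ^ cK
    ≡⟨ eq₄ (2 ^ (m + cB)) P a (2 ^ (m * ceilings u M + cM)) (2 ^ cK) ⟩
  2 ^ (m + cB) * 2 ^ (m * ceilings u M + cM) * 2 ^ cK * (a * P)
    ≡⟨ cong (_* (a * P)) (trans (cong (2 ^_) (eq₅ m (ceilings u M) cB cM cK))
         (trans (^-distribˡ-+-* 2 (m + cB + (m * ceilings u M + cM)) cK) (cong (_* 2 ^ cK) (^-distribˡ-+-* 2 (m + cB) (m * ceilings u M + cM))))) ⟨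
  2 ^ (m * suc (ceilings u M) + (cK + cM + cB)) * (a * P)
    ≡⟨ cong (_* (a * P)) (^-distribˡ-+-* 2 (m * suc (ceilings u M)) (cK + cM + cB)) ⟩
  y * 2 ^ (cK + cM + cB) * (a * P)
    ≡⟨ eq₆ y (2 ^ (cK + cM + cB)) a P ⟩
  a * 2 ^ (cK + cM + cB) * (P * y) ∎)
  where
  open ≤-Reasoning
  open Certificate cert
  X = m * 210
  a = L X ^ 64
  P = (selfPowers B ^ 64) ^ m
  x = 2 ^ (m * quotients l K)
  y = 2 ^ (m * suc (ceilings u M))
  cK = length K * (l + D)
  cM = length M * (u + C)
  cB = length B * 64 * 22
  eq₁ : ∀ a p y → a * (p * y) ≡ a * y * p
  eq₁ = solve-∀
  eq₂ : ∀ a x p → a * x * p ≡ a * p * x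
  eq₂ = solve-∀
  eq₃ : ∀ a b c → a * (b * c) ≡ b * a * c
  eq₃ = solve-∀
  eq₄ : ∀ e p a f c → e * p * (a * f) * c ≡ e * f * c * (a * p)
  eq₄ = solve-∀
  eq₅ : ∀ m c x y z → m * suc c + (z + y + x) ≡ m + x + (m * c + y) + z
  eq₅ = solve-∀
  eq₆ : ∀ y c a p → y * c * (a * p) ≡ a * c * (p * y)
  eq₆ = solve-∀
  exponents : m * l′ + m * suc (ceilings u M) ≤ m * g + m * quotients l K
  exponents = begin
    m * l′ + m * suc (ceilings u M)      ≡⟨ eq₇ m l′ (ceilings u M) ⟩
    m * (l′ + ceilings u M + 1)          ≤⟨ *-monoʳ-≤ m slopes ⟩
    m * (g + quotients l K)              ≡⟨ *-distribˡ-+ m g (quotients l K) ⟩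
    m * g + m * quotients l K            ∎
    where
    eq₇ : ∀ m l c → m * l + m * suc c ≡ m * (l + c + 1)
    eq₇ = solve-∀

lower-step : ∀ {A K B M u C l D} → Certificate A K B (1 ∷ M) → Upper u C → Lower l D →
             ∀ g l′ → 2 ^ g * selfPowers B ^ 64 ≤ selfPowers A ^ 64 → length B * 64 ≤ 4096 →
             l′ + ceilings u M + 1 ≤ g + quotients l K →
             Lower l′ (length K * (l + D) + length M * (u + C) + length B * 64 * 22)
lower-step {K = K} {B} {M} {u} {C} {l} {D} cert upper lower g l′ B≤A b≤ slopes = mkLower λ where
  zero      → lower-0 (length K * (l + D) + length M * (u + C) + length B * 64 * 22)
  m@(suc _) → lower-step⁺ cert upper lower g l′ B≤A b≤ slopes m

-- Concrete certificates and the numerical bounds on ψ.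

certificate : ∀ A K B M →
  {True (all? (_∣? 210) A)} → {True (all? (_∣? 210) B)} →
  {True (all? (λ k → 0 <? k ×-dec k ≤? 210) K)} → {True (all? (λ k → 0 <? k ×-dec k ≤? 210) M)} →
  {True (sum A ≟ sum B)} →
  {True (allUpTo? (λ Y → floors A Y + steps K Y ≤? floors B Y + steps M Y) 420)} →
  Certificate A K B M
certificate A K B M {A∣} {B∣} {K<} {M<} {Σ≡} {dom} = record
  { A∣210     = toWitness A∣
  ; B∣210     = toWitness B∣
  ; 0<K       = All.map proj₁ (toWitness K<)
  ; 0<M       = All.map proj₁ (toWitness M<)
  ; balanced  = toWitness Σ≡
  ; dominated = dominated-periodic {A} {K} {B} {M} (All.map proj₂ (toWitness K<)) (All.map proj₂ (toWitness M<))
                  (toWitness Σ≡) (toWitness dom)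
  }

-- Chebyshev's inequality ⌊Y⌋ + ⌊Y/30⌋ ≤ ⌊Y/2⌋ + ⌊Y/3⌋ + ⌊Y/5⌋ + [1 ≤ Y].
cert₁ : Certificate (210 ∷ 7 ∷ []) [] (105 ∷ 70 ∷ 42 ∷ []) (1 ∷ [])
cert₁ = certificate _ _ _ _

-- The divisors are 2, 3, 5, 7 on the left and 1, 10, 14, 210 on the right. The thresholds here and
-- in cert₃ were found by a computer search minimising the resulting error terms.
cert₂ : Certificate (105 ∷ 70 ∷ 42 ∷ 30 ∷ []) (1 ∷ 37 ∷ 79 ∷ [])
                    (210 ∷ 21 ∷ 15 ∷ 1 ∷ []) (6 ∷ 36 ∷ 66 ∷ 96 ∷ [])
cert₂ = certificate _ _ _ _

-- The divisors are 1, 6, 70 on the left and 2, 3, 5, 7, 210 on the right.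
cert₃ : Certificate (210 ∷ 35 ∷ 3 ∷ []) (14 ∷ 20 ∷ 110 ∷ [])
                    (105 ∷ 70 ∷ 42 ∷ 30 ∷ 1 ∷ []) (1 ∷ 13 ∷ 19 ∷ 73 ∷ 139 ∷ [])
cert₃ = certificate _ _ _ _

2^-assoc : ∀ a b c d → ((2 ^ a) ^ (b * c)) ^ d ≡ 2 ^ (b * (a * c * d) + 0)
2^-assoc a b c d = trans (cong (_^ d) (^-*-assoc 2 a (b * c)))
  (trans (^-*-assoc 2 (a * (b * c)) d) (cong (2 ^_) (eq a b c d)))
  where
  eq : ∀ a b c d → a * (b * c) * d ≡ b * (a * c * d) + 0
  eq = solve-∀

-- 26880 = 64 · 2 · 210.
upper₀ : Upper 26880 0
upper₀ = mkUpper λ m → ≤-trans (^-monoˡ-≤ 64 (L≤4^ (m * 210))) (≤-reflexive (2^-assoc 2 m 210 64))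

lower₀ : Lower 0 0
lower₀ = mkLower λ m → ≤-trans (≤-reflexive {2 ^ (m * 0)} {1} (cong (2 ^_) (*-zeroʳ m)))
  (≤-trans (m^n>0 (L (m * 210)) {{L≢0 (m * 210)}} 64) (≤-reflexive (sym (*-identityʳ (L (m * 210) ^ 64)))))

-- The first number passed to each step is 64 log₂ (selfPowers A / selfPowers B), up to sign, rounded
-- in the safe direction.
lower₁ : Lower 17862 4224
lower₁ = lower-step cert₁ upper₀ lower₀ 17863 17862 (≤ᵇ⇒≤ _ _ _) (≤ᵇ⇒≤ _ _ _) (≤ᵇ⇒≤ _ _ _)

upper₁ : Upper 22049 157324
upper₁ = upper-step cert₂ upper₀ lower₁ 16839 22049 (≤ᵇ⇒≤ _ _ _) (≤ᵇ⇒≤ _ _ _) (≤ᵇ⇒≤ _ _ _)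

-- Each further use of `cert₂` shrinks the distance of the slope from its fixed point by a factor of
-- about 1/6 + 1/36 + 1/66 + 1/96 ≈ 0.22, while its four thresholds roughly quadruple the constant.
upper₂ : Upper 20985 767296
upper₂ = upper-step cert₂ upper₁ lower₁ 16839 20985 (≤ᵇ⇒≤ _ _ _) (≤ᵇ⇒≤ _ _ _) (≤ᵇ⇒≤ _ _ _)

upper₃ : Upper 20750 3202928
upper₃ = upper-step cert₂ upper₂ lower₁ 16839 20750 (≤ᵇ⇒≤ _ _ _) (≤ᵇ⇒≤ _ _ _) (≤ᵇ⇒≤ _ _ _)

lower₂ : Lower 18182 12968010
lower₂ = lower-step cert₃ upper₃ lower₁ 18978 18182 (≤ᵇ⇒≤ _ _ _) (≤ᵇ⇒≤ _ _ _) (≤ᵇ⇒≤ _ _ _)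

-- Large and small n

isqrt : ∀ N → ∃[ r ] r * r ≤ N × N < suc r * suc r
isqrt zero = 0 , z≤n , s≤s z≤n
isqrt (suc N) with isqrt N
... | r , r²≤N , N<[1+r]² with suc N <? suc r * suc r
...   | yes 1+N< = r , m≤n⇒m≤1+n r²≤N , 1+N<
...   | no 1+N≮  = suc r , ≮⇒≥ 1+N≮ , <-≤-trans (s≤s N<[1+r]²)
          (*-mono-< (n<1+n (suc r)) (n<1+n (suc r)))

-- Decidability lets the proof by contradiction for large n return an actual prime.
primeBetween? : ∀ n → Dec (∃[ p ] (Prime p × 7 * n < p × p < 8 * n))
primeBetween? n with anyUpTo? (λ p → prime? p ×-dec 7 * n <? p) (8 * n)
... | yes (p , p<8n , pp , 7n<p) = yes (p , pp , 7n<p , p<8n)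
... | no ¬∃ = no λ { (p , pp , 7n<p , p<8n) → ¬∃ (p , p<8n , pp , 7n<p) }

-- Every q ≤ 8n beyond 7n is then a product of a factor at most √(8n) and a factor at most 4n.
L-8n∣ : ∀ n r → 1 < n → ¬ (∃[ p ] (Prime p × 7 * n < p × p < 8 * n)) → 8 * n < suc r * suc r →
        L (8 * n) ∣ L (7 * n) * L r
L-8n∣ n r 1<n none 8n<[1+r]² = L∣ (8 * n) divides-product
  where
  open ≤-Reasoning
  factors : ∀ a b → 1 < a → a ≤ b → a * b ≤ 8 * n → a * b ∣ L (7 * n) * L r
  factors a b 1<a a≤b ab≤8n = subst (a * b ∣_) (*-comm (L r) (L (7 * n)))
    (*-pres-∣ (∣L {{>-nonZero (<⇒≤ 1<a)}} a≤r) (∣L {{>-nonZero (≤-trans (<⇒≤ 1<a) a≤b)}} b≤7n))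
    where
    a≤r : a ≤ r
    a≤r = ≮⇒≥ λ r<a → <⇒≱ 8n<[1+r]² (≤-trans (*-mono-≤ r<a (≤-trans r<a a≤b)) ab≤8n)
    b≤4n : b ≤ 4 * n
    b≤4n = *-cancelˡ-≤ 2 (begin
      2 * b          ≤⟨ *-monoˡ-≤ b 1<a ⟩
      a * b          ≤⟨ ab≤8n ⟩
      8 * n          ≡⟨ *-assoc 2 4 n ⟩
      2 * (4 * n)    ∎)
    b≤7n : b ≤ 7 * n
    b≤7n = ≤-trans b≤4n (*-monoˡ-≤ n (≤ᵇ⇒≤ 4 7 _))
  composite-case : ∀ {q} → Composite q → q ≤ 8 * n → q ∣ L (7 * n) * L r
  composite-case {q} (composite {d} d<q d∣q) q≤8n with ≤-total d (quotient d∣q)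
  ... | inj₁ d≤e = subst (_∣ L (7 * n) * L r) (sym q≡)
          (factors d e (nonTrivial⇒n>1 d) d≤e (subst (_≤ 8 * n) q≡ q≤8n))
    where
    e  = quotient d∣q
    q≡ = m∣n⇒n≡m*quotient d∣q
  ... | inj₂ e≤d = subst (_∣ L (7 * n) * L r) (sym q≡)
          (factors e d (quotient>1 d∣q d<q) e≤d (subst (_≤ 8 * n) q≡ q≤8n))
    where
    e  = quotient d∣q
    q≡ = m∣n⇒n≡quotient*m d∣q
  divides-product : ∀ q → .{{NonZero q}} → q ≤ 8 * n → q ∣ L (7 * n) * L r
  divides-product q q≤8n with q ≤? 7 * n
  ... | yes q≤7n = ∣m⇒∣m*n (L r) (∣L q≤7n)
  ... | no q≰7n  = composite-case q-composite q≤8n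
    where
    7n<q = ≰⇒> q≰7n
    instance
      q>1 : NonTrivial q
      q>1 = n>1⇒nonTrivial (<-≤-trans (<-≤-trans 1<n (m≤n*m n 7)) (<⇒≤ 7n<q))
    q-composite : Composite q
    q-composite with m≤n⇒m<n∨m≡n q≤8n
    ... | inj₁ q<8n = ¬prime⇒composite λ pq → none (q , pq , 7n<q , q<8n)
    -- The endpoint 8n lies outside the open interval and is composite by its divisor 8.
    ... | inj₂ refl = composite {d = 8} (m<m*n 8 n 1<n) (m∣m*n n)

^-cancelʳ-≤ : ∀ a b → 2 ^ a ≤ 2 ^ b → a ≤ b
^-cancelʳ-≤ a b 2ᵃ≤2ᵇ = ≮⇒≥ λ b<a → <⇒≱ (^-monoʳ-< 2 (n<1+n 1) b<a) 2ᵃ≤2ᵇ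

-- n is enclosed between multiples of 210 to fit `Upper` and `Lower`; 128 = 64 · 2 comes from
-- `L r ≤ 4 ^ r`.
growth : ∀ {u C l D} → Upper u C → Lower l D → ∀ n t r → t * 210 ≤ n → n ≤ suc t * 210 →
         L (8 * n) ≤ L (7 * n) * L r → 8 * t * l ≤ 7 * suc t * u + C + r * 128 + D
growth {u} {C} {l} {D} upper lower n t r t≤n n≤t L8n≤ = ^-cancelʳ-≤ _ _ (begin
  2 ^ (8 * t * l)                                     ≤⟨ Lower.at lower (8 * t) ⟩
  L (8 * t * 210) ^ 64 * 2 ^ D                        ≤⟨ *-monoˡ-≤ (2 ^ D) (^-monoˡ-≤ 64 (begin
    L (8 * t * 210)                                     ≡⟨ cong L (*-assoc 8 t 210) ⟩
    L (8 * (t * 210))                                   ≤⟨ L-mono-≤ (*-monoʳ-≤ 8 t≤n) ⟩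
    L (8 * n)                                           ≤⟨ L8n≤ ⟩
    L (7 * n) * L r                                     ≤⟨ *-mono-≤ (L-mono-≤ (*-monoʳ-≤ 7 n≤t)) (L≤4^ r) ⟩
    L (7 * (suc t * 210)) * 4 ^ r                       ≡⟨ cong (λ k → L k * 4 ^ r) (*-assoc 7 (suc t) 210) ⟨
    L (7 * suc t * 210) * 4 ^ r                         ∎)) ⟩
  (L (7 * suc t * 210) * 4 ^ r) ^ 64 * 2 ^ D          ≡⟨ cong (_* 2 ^ D) (^-distribʳ-* 64 (L (7 * suc t * 210)) (4 ^ r)) ⟩
  L (7 * suc t * 210) ^ 64 * (4 ^ r) ^ 64 * 2 ^ D     ≤⟨ *-monoˡ-≤ (2 ^ D) (*-mono-≤ (Upper.at upper (7 * suc t)) (≤-reflexive (4^ 2 r 64))) ⟩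
  2 ^ (7 * suc t * u + C) * 2 ^ (r * 128) * 2 ^ D     ≡⟨ trans (^-distribˡ-+-* 2 (7 * suc t * u + C + r * 128) D) (cong (_* 2 ^ D) (^-distribˡ-+-* 2 (7 * suc t * u + C) (r * 128))) ⟨
  2 ^ (7 * suc t * u + C + r * 128 + D)               ∎)
  where
  open ≤-Reasoning
  4^ : ∀ a r c → ((2 ^ a) ^ r) ^ c ≡ 2 ^ (r * (a * c))
  4^ a r c = trans (cong (_^ c) (^-*-assoc 2 a r)) (trans (^-*-assoc 2 (a * r) c) (cong (2 ^_) (eq a r c)))
    where
    eq : ∀ a r c → a * r * c ≡ r * (a * c)
    eq = solve-∀

-- 2 k r ≤ r² + k² makes the inequality linear in t.
linearised : ∀ {t r} l u C D δ c w k s ε → 8 * l ≡ 7 * u + δ → c * w ≡ 2 * k → δ * w ≡ s + ε →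
             8 * t * l ≤ 7 * suc t * u + C + r * c + D → r * r ≤ suc t * s →
             t * ε ≤ (7 * u + C + D) * w + (s + k * k)
linearised {t} {r} l u C D δ c w k s ε 8l≡ cw≡ δw≡ growth-≤ r²≤ = +-cancelˡ-≤ (t * s) _ _ (begin
  t * s + t * ε                                       ≡⟨ *-distribˡ-+ t s ε ⟨
  t * (s + ε)                                         ≡⟨ cong (t *_) δw≡ ⟨
  t * (δ * w)                                         ≡⟨ *-assoc t δ w ⟨
  t * δ * w                                           ≤⟨ *-monoˡ-≤ w tδ≤ ⟩
  (7 * u + C + D + r * c) * w                         ≡⟨ eq₁ (7 * u + C + D) r c w ⟩
  (7 * u + C + D) * w + r * (c * w)                   ≡⟨ cong (λ z → (7 * u + C + D) * w + r * z) cw≡ ⟩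
  (7 * u + C + D) * w + r * (2 * k)                   ≤⟨ +-monoʳ-≤ ((7 * u + C + D) * w) (begin
    r * (2 * k)                                         ≡⟨ eq₂ r k ⟩
    2 * r * k ^ 1                                       ≤⟨ tangent r k 1 ⟩
    r ^ 2 + 1 * k ^ 2                                   ≡⟨ eq₃ r k ⟩
    r * r + k * k                                       ≤⟨ +-monoˡ-≤ (k * k) r²≤ ⟩
    suc t * s + k * k                                   ∎) ⟩
  (7 * u + C + D) * w + (suc t * s + k * k)           ≡⟨ eq₄ ((7 * u + C + D) * w) t s (k * k) ⟩
  t * s + ((7 * u + C + D) * w + (s + k * k))         ∎)
  where
  open ≤-Reasoning
  eq₀ : ∀ t u C x D → 7 * suc t * u + C + x + D ≡ t * (7 * u) + (7 * u + C + D + x)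
  eq₀ = solve-∀
  eq₀′ : ∀ t l → 8 * t * l ≡ t * (8 * l)
  eq₀′ = solve-∀
  eq₁ : ∀ a r c w → (a + r * c) * w ≡ a * w + r * (c * w)
  eq₁ = solve-∀
  eq₂ : ∀ r k → r * (2 * k) ≡ 2 * r * (k * 1)
  eq₂ = solve-∀
  eq₃ : ∀ r k → r * (r * 1) + 1 * (k * (k * 1)) ≡ r * r + k * k
  eq₃ = solve-∀
  eq₄ : ∀ a t s z → a + (suc t * s + z) ≡ t * s + (a + (s + z))
  eq₄ = solve-∀
  tδ≤ : t * δ ≤ 7 * u + C + D + r * c
  tδ≤ = +-cancelˡ-≤ (t * (7 * u)) _ _ (begin
    t * (7 * u) + t * δ                        ≡⟨ *-distribˡ-+ t (7 * u) δ ⟨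
    t * (7 * u + δ)                            ≡⟨ cong (t *_) 8l≡ ⟨
    t * (8 * l)                                ≡⟨ eq₀′ t l ⟨
    8 * t * l                                  ≤⟨ growth-≤ ⟩
    7 * suc t * u + C + r * c + D              ≡⟨ eq₀ t u C (r * c) D ⟩
    t * (7 * u) + (7 * u + C + D + r * c)      ∎)

prime-between-large : ∀ n → 20000000 ≤ n → ∃[ p ] (Prime p × 7 * n < p × p < 8 * n)
prime-between-large n n≥ with primeBetween? n
... | yes p = p
-- 4862471328 = 95238 · 51056, where 95238 = ⌊20000000/210⌋.
... | no none = contradiction (*-monoˡ-≤ 51056 t≥) (<⇒≱ (≤-<-trans t*ε≤ (<ᵇ⇒< 4445381264 4862471328 _)))
  where
  t = n / 210
  r = proj₁ (isqrt (8 * n))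
  r²≤8n = proj₁ (proj₂ (isqrt (8 * n)))
  8n<[1+r]² = proj₂ (proj₂ (isqrt (8 * n)))
  t≥ : 95238 ≤ t
  t≥ = /-monoˡ-≤ 210 n≥
  n≤ : n ≤ suc t * 210
  n≤ = <⇒≤ (m<suc[m/n]*n n 210)
  r²≤ : r * r ≤ suc t * 1680
  r²≤ = ≤-trans r²≤8n (≤-trans (*-monoʳ-≤ 8 n≤) (≤-reflexive (eq (suc t) 8 210)))
    where
    eq : ∀ t a b → a * (t * b) ≡ t * (b * a)
    eq = solve-∀
  1<n : 1 < n
  1<n = ≤-trans (≤ᵇ⇒≤ 2 20000000 _) n≥
  L8n≤ : L (8 * n) ≤ L (7 * n) * L r
  L8n≤ = ∣⇒≤ {{m*n≢0 (L (7 * n)) (L r) {{L≢0 (7 * n)}} {{L≢0 r}}}} (L-8n∣ n r 1<n none 8n<[1+r]²)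
  t*ε≤ : t * 51056 ≤ 4445381264
  -- δ = 8 · 18182 - 7 · 20750 = 206 and s = 8 · 210. The weight w = 256 leaves ε = 206 w - s =
  -- 51056 positive, and k = 128 w / 2.
  t*ε≤ = linearised {t} {r} 18182 20750 3202928 12968010 206 128 256 16384 1680 51056 refl refl refl
           (growth upper₃ lower₂ n t r (m/n*n≤m n 210) n≤ L8n≤) r²≤

-- Trial division and the chain of primes for small n.

trial : ℕ → ℕ → ℕ → Bool
trial zero       d n = false
trial (suc fuel) d n = if n <ᵇ suc d * suc d then true
                       else if n % suc d ≡ᵇ 0 then false else trial fuel (suc d) n

-- Roughness records that the divisors 2, ..., d are excluded. Exhausted fuel answers `false`, which
-- is harmless for soundness.
trial-sound : ∀ fuel d n → .{{NonTrivial n}} → suc d Rough n → T (trial fuel d n) → Prime n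
trial-sound (suc fuel) d n rough ok with n <ᵇ suc d * suc d in eq
... | true  = rough∧square>⇒prime rough (<ᵇ⇒< n (suc d * suc d) (subst T (sym eq) _))
... | false with n % suc d ≡ᵇ 0 in eq′
...   | false = trial-sound fuel (suc d) n (∤⇒rough-suc ∤n rough) ok
  where
  ∤n : suc d ∤ n
  ∤n ∣n = subst T eq′ (≡⇒≡ᵇ (n % suc d) 0 (n∣m⇒m%n≡0 n (suc d) ∣n))

isPrime : ℕ → Bool
isPrime n = (1 <ᵇ n) ∧ trial n 1 n

isPrime-sound : ∀ n → T (isPrime n) → Prime n
isPrime-sound n ok with Equivalence.to T-∧ ok
... | 1<n , trial-ok = trial-sound n 1 n {{n>1⇒nonTrivial (<ᵇ⇒< 1 n 1<n)}} 2-rough trial-ok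

-- If m ≤ 7n then n ≥ ⌈ m / 7 ⌉, so a prime below 8 ⌈ m / 7 ⌉ is below 8n.
chain : ℕ → List ℕ → Bool
chain m []       = true
chain m (p ∷ ps) = (p <ᵇ 8 * ((m + 6) / 7)) ∧ isPrime p ∧ chain p ps

end : ℕ → List ℕ → ℕ
end m []       = m
end m (p ∷ ps) = end p ps

chain-sound : ∀ m ps → T (chain m ps) → ∀ n → m ≤ 7 * n → 7 * n < end m ps →
              ∃[ p ] (Prime p × 7 * n < p × p < 8 * n)
chain-sound m [] _ n m≤7n 7n<m = contradiction m≤7n (<⇒≱ 7n<m)
chain-sound m (p ∷ ps) ok n m≤7n 7n<end with Equivalence.to T-∧ ok
... | p< , ok′ with Equivalence.to T-∧ ok′ | p ≤? 7 * n
...   | _  , ok″ | yes p≤7n = chain-sound p ps ok″ n p≤7n 7n<end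
...   | pp , _   | no p≰7n  = p , isPrime-sound p pp , ≰⇒> p≰7n , (begin-strict
  p                        <⟨ <ᵇ⇒< p _ p< ⟩
  8 * ((m + 6) / 7)        ≤⟨ *-monoʳ-≤ 8 (≤-trans (/-monoˡ-≤ 7 (+-monoˡ-≤ 6 m≤7n)) (≤-reflexive [7n+6]/7≡n)) ⟩
  8 * n                    ∎)
  where
  open ≤-Reasoning
  [7n+6]/7≡n : (7 * n + 6) / 7 ≡ n
  [7n+6]/7≡n = trans (cong (λ k → (k + 6) / 7) (*-comm 7 n))
    (trans (+-distrib-/-∣ˡ 6 (n∣m*n n)) (trans (cong (_+ 0) (m*n/n≡m n 7)) (+-identityʳ n)))

-- Consecutive entries grow by at most about 8/7; the last exceeds 7 · 20000000.
primes : List ℕ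
primes =
  23 ∷ 31 ∷ 37 ∷ 47 ∷ 53 ∷ 61 ∷ 71 ∷ 83 ∷ 89 ∷ 103 ∷ 113 ∷ 131 ∷ 151 ∷ 173 ∷ 199 ∷ 229 ∷ 263 ∷
  293 ∷ 331 ∷ 383 ∷ 439 ∷ 503 ∷ 571 ∷ 653 ∷ 751 ∷ 863 ∷ 991 ∷ 1129 ∷ 1291 ∷ 1471 ∷ 1669 ∷ 1907 ∷
  2179 ∷ 2477 ∷ 2819 ∷ 3221 ∷ 3677 ∷ 4201 ∷ 4801 ∷ 5483 ∷ 6271 ∷ 7159 ∷ 8179 ∷ 9349 ∷ 10687 ∷
  12211 ∷ 13933 ∷ 15923 ∷ 18199 ∷ 20789 ∷ 23753 ∷ 27143 ∷ 31019 ∷ 35449 ∷ 40519 ∷ 46309 ∷ 52919 ∷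
  60457 ∷ 69073 ∷ 78941 ∷ 90217 ∷ 103099 ∷ 117811 ∷ 134639 ∷ 153877 ∷ 175859 ∷ 200983 ∷ 229693 ∷
  262511 ∷ 300007 ∷ 342871 ∷ 391847 ∷ 447829 ∷ 511801 ∷ 584917 ∷ 668471 ∷ 763967 ∷ 873109 ∷
  997813 ∷ 1140353 ∷ 1303261 ∷ 1489441 ∷ 1702219 ∷ 1945399 ∷ 2223317 ∷ 2540933 ∷ 2903909 ∷
  3318719 ∷ 3792821 ∷ 4334653 ∷ 4953877 ∷ 5661559 ∷ 6470341 ∷ 7394627 ∷ 8451007 ∷ 9658291 ∷
  11038037 ∷ 12614869 ∷ 14416967 ∷ 16476521 ∷ 18830297 ∷ 21520307 ∷ 24594617 ∷ 28108109 ∷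
  32123549 ∷ 36712631 ∷ 41957249 ∷ 47951131 ∷ 54801293 ∷ 62630041 ∷ 71577151 ∷ 81802439 ∷
  93488501 ∷ 106843987 ∷ 122107399 ∷ 139551299 ∷ 159487177 ∷ []

corollary2p2p14 : ∀ (n : ℕ) → n > 2 → ∃[ p ] (Prime p × 7 * n < p × p < 8 * n)
corollary2p2p14 n n>2 with 20000000 ≤? n
... | yes n≥ = prime-between-large n n≥
-- The chain starts from 21 = 7 · 3, the least value of 7n.
... | no n≱  = chain-sound 21 primes _ n (*-monoʳ-≤ 7 n>2)
  (<-≤-trans (*-monoʳ-< 7 (≰⇒> n≱)) (≤ᵇ⇒≤ 140000000 (end 21 primes) _))
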